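{- Fix integers $r\ge 4$ and $k\ge 2$, a real $B>0$, and a real $$\beta<\frac{2r-2}{2r-3}.$$ There is $M=M(r,k,B,\beta)$ such that the following holds. If a graph $G$ contains a subgraph $J$ with $$\chi(J)=m\ge M,\qquad |V(J)|\le B m^\beta,$$ then $G$ contains a subgraph $H$ with $\operatorname{girth}(H)\ge r$ and $\chi(H)\ge k$.
   Context: All graphs are finite and simple; subgraphs need not be induced. $\chi$ is the chromatic number. The girth of a forest is $\infty$. -}

module Defs where

open import Data.Empty using (⊥)
open import Data.Fin.Base as Fin using (Fin; zero; suc; toℕ; fromℕ; fromℕ<; inject₁; finToFun; funToFin)
import Data.Fin.Properties as Fin
open import Data.Fin.Subset using (Subset; _∈_; _⊆_)
open import Data.Fin.Subset.Properties using (_∈?_)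
open import Data.Integer.Base using (+_; -[1+_])
open import Data.Nat.Base using (ℕ; zero; suc; _+_; _*_; _∸_; _≤_; _<_; NonZero; >-nonZero; s≤s)
import Data.Nat.Base as ℕ
import Data.Nat.Properties as ℕ
open import Data.Product using (∃; ∃-syntax; _×_; _,_; proj₁; proj₂)
open import Data.Rational.Base as ℚ using (ℚ; _/_; 0ℚ; 1ℚ; ↥_; ↧ₙ_)
import Data.Rational.Properties as ℚ
open import Data.Sum.Base using (_⊎_; inj₁; inj₂)
open import Function.Base using (_∘_)
open import Function.Definitions using (Injective)
open import Level using (0ℓ)
open import Relation.Binary.Core using (Rel)
open import Relation.Binary.Definitions using (Decidable; Symmetric; Irreflexive)
open import Relation.Binary.PropositionalEquality
  using (_≡_; _≢_; _≗_; refl; sym; trans; cong; subst; subst₂)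
open import Relation.Nullary using (¬_; Dec; yes; no; contradiction)
open import Relation.Nullary.Construct.Add.Supremum using (_⁺; [_]; ⊤⁺)
open import Relation.Nullary.Decidable using (map′; _×-dec_; _→-dec_; ¬?)
open import Relation.Unary using (Pred)
import Relation.Unary as Unary

import Algebra.Definitions.RawSemiring ℚ.+-*-rawSemiring as ℚ^

-- Two-sided Dedekind cuts of ℚ.
record ℝ : Set₁ where
  field
    L U         : Pred ℚ 0ℓ
    L-inhabited : ∃ L
    U-inhabited : ∃ U
    L-lower     : ∀ {p q} → p ℚ.< q → L q → L p
    U-upper     : ∀ {p q} → p ℚ.< q → U p → U q
    L-open      : ∀ {p} → L p → ∃[ q ] p ℚ.< q × L q
    U-open      : ∀ {q} → U q → ∃[ p ] p ℚ.< q × U p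
    disjoint    : ∀ {q} → ¬ (L q × U q)
    located     : ∀ {p q} → p ℚ.< q → L p ⊎ U q

open ℝ

infix 4 _<ʳ_

_<ʳ_ : Rel ℝ 0ℓ
x <ʳ y = ∃[ q ] U x q × L y q

private
  0<1 : 0ℚ ℚ.< 1ℚ
  0<1 = ℚ.positive⁻¹ 1ℚ

  p<p+1 : ∀ p → p ℚ.< p ℚ.+ 1ℚ
  p<p+1 p = subst (ℚ._< p ℚ.+ 1ℚ) (ℚ.+-identityʳ p) (ℚ.+-monoʳ-< p 0<1)

  p-1<p : ∀ p → p ℚ.- 1ℚ ℚ.< p
  p-1<p p = subst (p ℚ.- 1ℚ ℚ.<_) (ℚ.+-identityʳ p) (ℚ.+-monoʳ-< p (ℚ.neg-antimono-< 0<1))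

fromℚ : ℚ → ℝ
fromℚ r = record
  { L           = ℚ._< r
  ; U           = r ℚ.<_
  ; L-inhabited = r ℚ.- 1ℚ , p-1<p r
  ; U-inhabited = r ℚ.+ 1ℚ , p<p+1 r
  ; L-lower     = ℚ.<-trans
  ; U-upper     = λ p<q r<p → ℚ.<-trans r<p p<q
  ; L-open      = ℚ.<-dense
  ; U-open      = λ r<q → let p , r<p , p<q = ℚ.<-dense r<q in p , p<q , r<p
  ; disjoint    = λ (q<r , r<q) → ℚ.<-asym q<r r<q
  ; located     = loc
  }
  where
  loc : ∀ {p q} → p ℚ.< q → p ℚ.< r ⊎ r ℚ.< q
  loc {p} p<q with p ℚ.<? r
  ... | yes p<r = inj₁ p<r
  ... | no  p≮r = inj₂ (ℚ.≤-<-trans (ℚ.≮⇒≥ p≮r) p<q)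

0ℝ : ℝ
0ℝ = fromℚ 0ℚ

fromℕ→ℚ : ℕ → ℚ
fromℕ→ℚ n = + n / 1

-- n ≤ b·mᵉ for rational b > 0 and e = a/d, with the d-th root cleared by
-- raising to the power d, and a negative power of m moved to the left.
infix 4 _≤ℚ[_·_^_] _≤ℝ[_·_^_]

_≤ℚ[_·_^_] : ℕ → ℚ → ℕ → ℚ → Set
n ≤ℚ[ b · m ^ e ] with ↥ e
... | + a      = N ℚ^.^ (↧ₙ e) ℚ.≤ (b ℚ^.^ (↧ₙ e)) ℚ.* (M ℚ^.^ a)
  where N = fromℕ→ℚ n ; M = fromℕ→ℚ m
... | -[1+ a ] = (N ℚ^.^ (↧ₙ e)) ℚ.* (M ℚ^.^ suc a) ℚ.≤ b ℚ^.^ (↧ₙ e)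
  where N = fromℕ→ℚ n ; M = fromℕ→ℚ m

-- n ≤ B·m^β for real B > 0 and β.  For m ≥ 1 the real number B·m^β is the
-- infimum of the b·mᵉ over rationals b > B and e > β, so this holds exactly
-- when n is at most each of those.
_≤ℝ[_·_^_] : ℕ → ℝ → ℕ → ℝ → Set
n ≤ℝ[ B · m ^ β ] = ∀ b e → U B b → U β e → n ≤ℚ[ b · m ^ e ]

-- No truncation occurs in ∸ because 4 ≤ r.
threshold : (r : ℕ) → 4 ≤ r → ℚ
threshold r 4≤r = _/_ (+ (2 * r ∸ 2)) (2 * r ∸ 3) {{nz}}
  where
  nz : NonZero (2 * r ∸ 3)
  nz = >-nonZero (ℕ.m<n⇒0<n∸m (ℕ.≤-trans 4≤r (ℕ.m≤m+n r (r + 0))))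

IsLeast : Pred ℕ 0ℓ → Pred ℕ 0ℓ
IsLeast P n = P n × (∀ k → P k → n ≤ k)

-- ⊤⁺ plays the role of ∞, the infimum of the empty set; hence the girth of a
-- forest is ∞.
IsInfimum : Pred ℕ 0ℓ → ℕ ⁺ → Set
IsInfimum P [ n ] = IsLeast P n
IsInfimum P ⊤⁺    = ∀ k → ¬ P k

private
  search : ∀ {P : Pred ℕ 0ℓ} → Unary.Decidable P →
           ∀ n → ∃ (IsLeast P) ⊎ (∀ k → P k → n ≤ k)
  search P? zero = inj₂ λ _ _ → ℕ.z≤n
  search {P} P? (suc n) with search P? n
  ... | inj₁ least = inj₁ least
  ... | inj₂ n≤ with P? n
  ...   | yes Pn = inj₁ (n , Pn , n≤)
  ...   | no ¬Pn = inj₂ λ k Pk →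
    ℕ.≤∧≢⇒< (n≤ k Pk) λ n≡k → ¬Pn (subst P (sym n≡k) Pk)

  anyFun? : ∀ {m n} {P : Pred (Fin m → Fin n) 0ℓ} →
            (∀ {f g} → f ≗ g → P f → P g) → Unary.Decidable P → Dec (∃ P)
  anyFun? resp P? = map′
    (λ (i , Pi) → finToFun i , Pi)
    (λ (f , Pf) → funToFin f , resp (sym ∘ Fin.finToFun-funToFin f) Pf)
    (Fin.any? (P? ∘ finToFun))

-- A finite simple graph whose vertex set V is a subset of the labels Fin N.
-- Keeping V separate from the labels makes the subgraph relation literal
-- inclusion of vertex sets and of edge sets.
record Graph (N : ℕ) : Set₁ where
  infix 4 _~_ _~?_
  field
    V        : Subset N
    _~_      : Rel (Fin N) 0ℓ
    _~?_     : Decidable _~_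
    ~-sym    : Symmetric _~_
    ~-irrefl : Irreflexive _≡_ _~_
    ~⇒∈      : ∀ {x y} → x ~ y → x ∈ V

open Graph using (V)

infix 4 _⊑_

record _⊑_ {N} (H G : Graph N) : Set where
  field
    V-⊆ : V H ⊆ V G
    E-⊆ : ∀ {x y} → Graph._~_ H x y → Graph._~_ G x y

module _ {N} (G : Graph N) where
  open Graph G using (_~_; _~?_; ~⇒∈; ~-sym)

  -- Only the values of c on the vertex set matter, so that the graph with no
  -- vertices is 0-colourable.
  IsColouring : ℕ → Pred (Fin N → ℕ) 0ℓ
  IsColouring k c = (∀ x → x ∈ V G → c x < k) × (∀ x y → x ~ y → c x ≢ c y)

  Colourable : Pred ℕ 0ℓ
  Colourable k = ∃ (IsColouring k)

  IsCycle : ∀ {l} → Pred (Fin (suc l) → Fin N) 0ℓ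
  IsCycle {l} c =
    Injective _≡_ _≡_ c × (∀ i → c (inject₁ i) ~ c (suc i)) × c (fromℕ l) ~ c zero

  HasCycle : Pred ℕ 0ℓ
  HasCycle zero    = ⊥
  HasCycle (suc l) = 3 ≤ suc l × ∃ (IsCycle {l})

  private
    isColouring? : ∀ k → Unary.Decidable (IsColouring k)
    isColouring? k c =
      Fin.all? (λ x → (x ∈? V G) →-dec (c x ℕ.<? k)) ×-dec
      Fin.all? (λ x → Fin.all? λ y → (x ~? y) →-dec ¬? (c x ℕ.≟ c y))

    isColouring-resp : ∀ {k c c′} → (∀ x → x ∈ V G → c x ≡ c′ x) →
                       IsColouring k c → IsColouring k c′
    isColouring-resp c≡c′ (bounded , proper) =
      (λ x x∈V → subst (_< _) (c≡c′ x x∈V) (bounded x x∈V)) ,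
      (λ x y x~y → subst₂ _≢_ (c≡c′ x (~⇒∈ x~y)) (c≡c′ y (~⇒∈ (~-sym x~y)))
                          (proper x y x~y))

    colourable? : Unary.Decidable Colourable
    colourable? k = map′
      (λ (f , col) → toℕ ∘ f , col)
      (λ (c , col) → clip c , isColouring-resp (clip-≡ c (proj₁ col)) col)
      (anyFun? {n = suc k} (λ f≗g → isColouring-resp λ x _ → cong toℕ (f≗g x))
               (λ f → isColouring? k (toℕ ∘ f)))
      where
      clip : (Fin N → ℕ) → Fin N → Fin (suc k)
      clip c x = fromℕ< (s≤s (ℕ.m⊓n≤n (c x) k))

      clip-≡ : ∀ c → (∀ x → x ∈ V G → c x < k) →
               ∀ x → x ∈ V G → c x ≡ toℕ (clip c x)
      clip-≡ c bounded x x∈V =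
        sym (trans (Fin.toℕ-fromℕ< _) (ℕ.m≤n⇒m⊓n≡m (ℕ.<⇒≤ (bounded x x∈V))))

    N-colourable : Colourable N
    N-colourable = toℕ , (λ x _ → Fin.toℕ<n x) ,
      λ x y x~y x≡y → Graph.~-irrefl G (Fin.toℕ-injective x≡y) x~y

    injective? : ∀ {l} → Unary.Decidable {A = Fin l → Fin N} (Injective _≡_ _≡_)
    injective? c = map′ (λ inj {x} {y} → inj x y) (λ inj x y → inj {x} {y})
      (Fin.all? λ x → Fin.all? λ y → (c x Fin.≟ c y) →-dec (x Fin.≟ y))

    isCycle? : ∀ {l} → Unary.Decidable (IsCycle {l})
    isCycle? c = injective? c ×-dec (Fin.all? (λ i → _ ~? _) ×-dec (_ ~? _))

    isCycle-resp : ∀ {l} {c c′ : Fin (suc l) → Fin N} →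
                   c ≗ c′ → IsCycle c → IsCycle c′
    isCycle-resp c≗c′ (inj , step , close) =
      (λ {x} {y} eq → inj (trans (c≗c′ x) (trans eq (sym (c≗c′ y))))) ,
      (λ i → subst₂ _~_ (c≗c′ _) (c≗c′ _) (step i)) ,
      subst₂ _~_ (c≗c′ _) (c≗c′ _) close

    hasCycle? : Unary.Decidable HasCycle
    hasCycle? zero    = no λ ()
    hasCycle? (suc l) = (3 ℕ.≤? suc l) ×-dec anyFun? isCycle-resp isCycle?

    cycle-length≤N : ∀ l → HasCycle l → l ≤ N
    cycle-length≤N (suc l) (_ , _ , inj , _) = Fin.injective⇒≤ inj

  χ-least : ∃ (IsLeast Colourable)
  χ-least with search colourable? (suc N)
  ... | inj₁ least = least
  ... | inj₂ none  = contradiction (none N N-colourable) ℕ.1+n≰n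

  χ : ℕ
  χ = proj₁ χ-least

  girth-infimum : ∃ (IsInfimum HasCycle)
  girth-infimum with search hasCycle? (suc N)
  ... | inj₁ (g , least) = [ g ] , least
  ... | inj₂ none        = ⊤⁺ , λ l cyc →
    ℕ.1+n≰n (ℕ.≤-trans (none l cyc) (cycle-length≤N l cyc))

  girth : ℕ ⁺
  girth = proj₁ girth-infimum

{-# OPTIONS --safe #-}
module Submission where

open import Defs
open Graph

open import Data.Empty using (⊥)
open import Data.Fin.Base using (Fin; zero; suc; toℕ; fromℕ<; combine)
open import Data.Fin.Properties as Fin
  using (_≟_; suc-injective; toℕ-injective; toℕ<n; toℕ-fromℕ; toℕ-fromℕ<; toℕ-inject₁;
         toℕ-combine; combine-injective)
open import Data.Fin.Relation.Unary.Top using (view; ‵fromℕ; ‵inject₁)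
open import Data.Fin.Subset using (Subset; ∣_∣; inside; outside; _∈_)
import Data.Integer.Base as ℤ
import Data.Integer.Properties as ℤ
open import Data.List.Base
  using (List; []; _∷_; _++_; map; length; allFin; cartesianProduct; cartesianProductWith)
open import Data.List.Membership.Propositional as List using (find)
open import Data.List.Membership.Propositional.Properties
  using (∈-map⁺; ∈-allFin; ∈-cartesianProduct⁺; ∈-cartesianProductWith⁺)
open import Data.List.Properties using (map-tabulate; length-tabulate; length-++; length-map)
open import Data.List.Relation.Unary.All as All using (All; []; _∷_)
import Data.List.Relation.Unary.All.Properties as All
open import Data.List.Relation.Unary.AllPairs using ([]; _∷_)
open import Data.List.Relation.Unary.Any using (here; there; any?)
open import Data.List.Relation.Unary.Unique.Propositional using (Unique)
import Data.List.Relation.Unary.Unique.Propositional.Properties as Unique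
open import Data.Nat.Base
open import Data.Nat.Coprimality using (Coprime; 1-coprimeTo) renaming (sym to coprime-sym)
open import Data.Nat.DivMod using (_mod_; m<n⇒m%n≡m; m%n<n; m≡m%n+[m/n]*n; m/n*n≤m)
open import Data.Nat.ListAction using (sum; product)
open import Data.Nat.Properties as ℕ hiding (_≟_; suc-injective)
open import Data.Nat.Tactic.RingSolver using (solve-∀)
open import Data.Product using (∃-syntax; _×_; _,_; proj₁; proj₂; uncurry)
open import Data.Rational.Base as ℚ using (mkℚ)
import Data.Rational.Properties as ℚ
open import Data.Rational.Unnormalised.Base using (mkℚᵘ)
import Data.Rational.Unnormalised.Properties as ℚᵘ
open import Data.Sum.Base using (_⊎_; inj₁; inj₂; swap)
open import Data.Vec.Base using (Vec; []; _∷_; here; there; lookup; tabulate; _[_]≔_)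
open import Data.Vec.Functional using (updateAt)
open import Data.Vec.Functional.Properties using (updateAt-updates; updateAt-minimal)
open import Data.Vec.Properties using (lookup∘tabulate; lookup∘update′)
open import Function.Base using (_∘_; id)
open import Function.Definitions using (Injective)
open import Level using (Level)
open import Relation.Binary.Construct.Add.Supremum.NonStrict _≤_ using (_≤⁺_; [_]; _≤⊤⁺)
open import Relation.Binary.PropositionalEquality
open import Relation.Nullary using (Dec; yes; no; ¬_; contradiction)
open import Relation.Nullary.Construct.Add.Supremum using ([_]; ⊤⁺)
open import Relation.Nullary.Decidable using (_×-dec_; _⊎-dec_; _→-dec_)
open import Relation.Unary using (Pred; Decidable)

import Algebra.Definitions.RawSemiring ℚ.+-*-rawSemiring as ℚ^
open import Algebra.Properties.CommutativeSemigroup +-commutativeSemigroup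
  using () renaming (interchange to +-interchange)
open import Algebra.Properties.CommutativeSemigroup *-commutativeSemigroup
  using () renaming (interchange to *-interchange; x∙yz≈y∙xz to m*[n*o]≡n*[m*o])

-- Let m = χ(J) and n = |V(J)|.  For every colouring of V(J) with k − 1 colours,
-- the monochromatic subgraph has chromatic number at least m/(k−1), hence order
-- m² edges, since an optimal colouring has an edge between any two classes.
-- Sample t of the n² ordered pairs of vertices independently, with t of order
-- n³/m².  Then for each of the (k−1)ⁿ colourings the sample has at most n
-- monochromatic edges with probability at most (k−1)⁻ⁿ/4.  On the other hand the
-- expected number of cycles of length l < r in the sample is at most
-- (2t/n)^l = O((n/m)^2l), which is o(n) because n ≤ B m^β with
-- β < (2r−2)/(2r−3).  So some sample has fewer than n short cycles and more than
-- n monochromatic edges for every colouring; deleting the first edge of each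
-- short cycle leaves a graph of girth at least r that is not (k−1)-colourable.
-- Probabilities are expressed by sums over all words of length t.

private
  variable
    ℓ₁ ℓ₂ ℓ₃ : Level
    A : Set ℓ₁
    B : Set ℓ₂
    E : Set ℓ₃
    P : Set ℓ₁
    N k l t : ℕ

-- Arithmetic of powers.

^-distribʳ-* : ∀ m n e → (m * n) ^ e ≡ m ^ e * n ^ e
^-distribʳ-* m n zero    = refl
^-distribʳ-* m n (suc e) rewrite ^-distribʳ-* m n e =
  *-interchange m n (m ^ e) (n ^ e)

0<^ : ∀ {m} n → 0 < m → 0 < m ^ n
0<^ {m} n 0<m = m^n>0 m {{>-nonZero 0<m}} n

*-cancelˡ-≤-pos : ∀ m {n o} → 0 < m → m * n ≤ m * o → n ≤ o
*-cancelˡ-≤-pos m 0<m = *-cancelˡ-≤ m {{>-nonZero 0<m}}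

^-cancelˡ-≤ : ∀ d {m n} → 0 < d → m ^ d ≤ n ^ d → m ≤ n
^-cancelˡ-≤ d {m} {n} 0<d le with m ≤? n
... | yes m≤n = m≤n
... | no  m≰n = contradiction (^-monoˡ-< d {{>-nonZero 0<d}} (≰⇒> m≰n)) (≤⇒≯ le)

-- Finite sums and products over lists.

∑ ∏ : List A → (A → ℕ) → ℕ
∑ xs f = sum (map f xs)
∏ xs f = product (map f xs)

infix 5 ∑ ∏
syntax ∑ xs (λ x → e) = ∑[ x ∈ xs ] e
syntax ∏ xs (λ x → e) = ∏[ x ∈ xs ] e

∑-cong : ∀ (xs : List A) {f g : A → ℕ} → (∀ x → f x ≡ g x) → ∑ xs f ≡ ∑ xs g
∑-cong []       f≡g = refl
∑-cong (x ∷ xs) f≡g = cong₂ _+_ (f≡g x) (∑-cong xs f≡g)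

∑-mono : ∀ (xs : List A) {f g : A → ℕ} → (∀ x → f x ≤ g x) → ∑ xs f ≤ ∑ xs g
∑-mono []       f≤g = z≤n
∑-mono (x ∷ xs) f≤g = +-mono-≤ (f≤g x) (∑-mono xs f≤g)

∑-const : ∀ (xs : List A) m → ∑[ _ ∈ xs ] m ≡ length xs * m
∑-const []       m = refl
∑-const (x ∷ xs) m = cong (m +_) (∑-const xs m)

∑-distrib-+ : ∀ (xs : List A) (f g : A → ℕ) → ∑[ x ∈ xs ] (f x + g x) ≡ ∑ xs f + ∑ xs g
∑-distrib-+ []       f g = refl
∑-distrib-+ (x ∷ xs) f g rewrite ∑-distrib-+ xs f g =
  +-interchange (f x) (g x) (∑ xs f) (∑ xs g)

*-distribˡ-∑ : ∀ m (xs : List A) (f : A → ℕ) → ∑[ x ∈ xs ] (m * f x) ≡ m * ∑ xs f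
*-distribˡ-∑ m []       f = sym (*-zeroʳ m)
*-distribˡ-∑ m (x ∷ xs) f =
  trans (cong (m * f x +_) (*-distribˡ-∑ m xs f)) (sym (*-distribˡ-+ m (f x) _))

*-distribʳ-∑ : ∀ m (xs : List A) (f : A → ℕ) → ∑[ x ∈ xs ] (f x * m) ≡ ∑ xs f * m
*-distribʳ-∑ m xs f = trans (∑-cong xs λ x → *-comm (f x) m)
  (trans (*-distribˡ-∑ m xs f) (*-comm m _))

∑-bound : ∀ m {n} (xs : List A) {f : A → ℕ} → (∀ x → m * f x ≤ n) → m * ∑ xs f ≤ length xs * n
∑-bound m {n} xs {f} mf≤n = begin
  m * ∑ xs f             ≡⟨ *-distribˡ-∑ m xs f ⟨
  ∑[ x ∈ xs ] (m * f x)  ≤⟨ ∑-mono xs mf≤n ⟩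
  ∑[ _ ∈ xs ] n          ≡⟨ ∑-const xs n ⟩
  length xs * n          ∎
  where open ≤-Reasoning

∑-*-∑ : ∀ (xs : List A) (ys : List B) (f : A → ℕ) (g : B → ℕ) →
        ∑[ x ∈ xs ] ∑[ y ∈ ys ] (f x * g y) ≡ ∑ xs f * ∑ ys g
∑-*-∑ xs ys f g =
  trans (∑-cong xs λ x → *-distribˡ-∑ (f x) ys g) (*-distribʳ-∑ (∑ ys g) xs f)

∑-swap : ∀ (xs : List A) (ys : List B) (f : A → B → ℕ) →
         ∑[ x ∈ xs ] ∑[ y ∈ ys ] f x y ≡ ∑[ y ∈ ys ] ∑[ x ∈ xs ] f x y
∑-swap []       ys f = sym (trans (∑-const ys 0) (*-zeroʳ (length ys)))
∑-swap (x ∷ xs) ys f = trans (cong (∑ ys (f x) +_) (∑-swap xs ys f))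
  (sym (∑-distrib-+ ys (f x) λ y → ∑[ x ∈ xs ] f x y))

∑-++ : ∀ (xs ys : List A) (f : A → ℕ) → ∑ (xs ++ ys) f ≡ ∑ xs f + ∑ ys f
∑-++ []       ys f = refl
∑-++ (x ∷ xs) ys f = trans (cong (f x +_) (∑-++ xs ys f)) (sym (+-assoc (f x) _ _))

∑-map : ∀ (h : A → B) (xs : List A) (f : B → ℕ) → ∑ (map h xs) f ≡ ∑ xs (f ∘ h)
∑-map h []       f = refl
∑-map h (x ∷ xs) f = cong (f (h x) +_) (∑-map h xs f)

∑-cartesianProductWith : ∀ (h : A → B → E) (xs : List A) (ys : List B) (f : E → ℕ) →
  ∑ (cartesianProductWith h xs ys) f ≡ ∑[ x ∈ xs ] ∑[ y ∈ ys ] f (h x y)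
∑-cartesianProductWith h []       ys f = refl
∑-cartesianProductWith h (x ∷ xs) ys f =
  trans (∑-++ (map (h x) ys) _ f)
        (cong₂ _+_ (∑-map (h x) ys f) (∑-cartesianProductWith h xs ys f))

length-cartesianProductWith : ∀ (h : A → B → E) (xs : List A) (ys : List B) →
  length (cartesianProductWith h xs ys) ≡ length xs * length ys
length-cartesianProductWith h []       ys = refl
length-cartesianProductWith h (x ∷ xs) ys = trans (length-++ (map (h x) ys))
  (cong₂ _+_ (length-map (h x) ys) (length-cartesianProductWith h xs ys))

length-allFin : ∀ n → length (allFin n) ≡ n
length-allFin n = length-tabulate id

∑-allFin-suc : ∀ n (f : Fin (suc n) → ℕ) →
               ∑ (allFin (suc n)) f ≡ f zero + ∑ (allFin n) (f ∘ suc)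
∑-allFin-suc n f = cong (λ ys → f zero + sum ys)
  (trans (map-tabulate suc f) (sym (map-tabulate (λ i → i) (f ∘ suc))))

∈⇒≤∑ : ∀ {x} {xs : List A} (f : A → ℕ) → x List.∈ xs → f x ≤ ∑ xs f
∈⇒≤∑ f (here refl)  = m≤m+n _ _
∈⇒≤∑ f (there x∈xs) = ≤-trans (∈⇒≤∑ f x∈xs) (m≤n+m _ _)

∑<⇒∃< : ∀ (xs : List A) (f : A → ℕ) m → ∑ xs f < length xs * m → ∃[ x ] f x < m
∑<⇒∃< (x ∷ xs) f m lt with f x <? m
... | yes fx<m = x , fx<m
... | no  fx≮m = ∑<⇒∃< xs f m
  (+-cancelˡ-< m _ _ (≤-<-trans (+-monoˡ-≤ _ (≮⇒≥ fx≮m)) lt))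

0<∏ : ∀ (xs : List A) {f : A → ℕ} → (∀ x → 0 < f x) → 0 < ∏ xs f
0<∏ []       0<f = ≤-refl
0<∏ (x ∷ xs) 0<f = *-mono-≤ (0<f x) (0<∏ xs 0<f)

∏-cong-All : ∀ {xs : List A} {f g : A → ℕ} → All (λ x → f x ≡ g x) xs → ∏ xs f ≡ ∏ xs g
∏-cong-All []           = refl
∏-cong-All (f≡g ∷ fs≡gs) = cong₂ _*_ f≡g (∏-cong-All fs≡gs)

-- Sums over words, which stand for independent sampling.

words : List A → ∀ t → List (Vec A t)
words xs zero    = [] ∷ []
words xs (suc t) = cartesianProductWith _∷_ xs (words xs t)

length-words : ∀ (xs : List A) t → length (words xs t) ≡ length xs ^ t
length-words xs zero    = refl
length-words xs (suc t) = trans (length-cartesianProductWith _∷_ xs (words xs t))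
  (cong (length xs *_) (length-words xs t))

∈-words : ∀ {xs : List A} {t} (w : Vec A t) → (∀ i → lookup w i List.∈ xs) → w List.∈ words xs t
∈-words []      _    = here refl
∈-words (x ∷ w) w∈xs =
  ∈-cartesianProductWith⁺ _∷_ (w∈xs zero) (∈-words w (w∈xs ∘ suc))

-- The weight is a product of one factor for each letter, so the sum over words factorises. Up to
-- normalisation this is the moment generating function of a sum of independent terms, the source of
-- the Chernoff bound for misses.
∑-words-^ : ∀ m (f : A → ℕ) (xs : List A) t →
  ∑[ w ∈ words xs t ] m ^ (∑[ i ∈ allFin t ] f (lookup w i)) ≡ (∑[ x ∈ xs ] m ^ f x) ^ t
∑-words-^ m f xs zero    = refl
∑-words-^ m f xs (suc t) = begin
  ∑[ w ∈ words xs (suc t) ] m ^ (∑[ i ∈ allFin (suc t) ] f (lookup w i))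
    ≡⟨ ∑-cartesianProductWith _∷_ xs (words xs t) _ ⟩
  ∑[ x ∈ xs ] ∑[ w ∈ words xs t ] m ^ (∑[ i ∈ allFin (suc t) ] f (lookup (x ∷ w) i))
    ≡⟨ (∑-cong xs λ x → ∑-cong (words xs t) λ w →
         trans (cong (m ^_) (∑-allFin-suc t (f ∘ lookup (x ∷ w)))) (^-distribˡ-+-* m (f x) _)) ⟩
  ∑[ x ∈ xs ] ∑[ w ∈ words xs t ] (m ^ f x * m ^ (∑[ i ∈ allFin t ] f (lookup w i)))
    ≡⟨ ∑-*-∑ xs (words xs t) _ _ ⟩
  (∑[ x ∈ xs ] m ^ f x) * (∑[ w ∈ words xs t ] m ^ (∑[ i ∈ allFin t ] f (lookup w i)))
    ≡⟨ cong ((∑[ x ∈ xs ] m ^ f x) *_) (∑-words-^ m f xs t) ⟩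
  (∑[ x ∈ xs ] m ^ f x) ^ suc t ∎
  where open ≡-Reasoning

∑-*-constant : ∀ (xs : List A) (f g : A → ℕ) → (∀ x y → g x ≡ g y) →
               length xs * (∑[ x ∈ xs ] (f x * g x)) ≡ ∑ xs f * ∑ xs g
∑-*-constant []           f g g-const = refl
∑-*-constant xs@(x₀ ∷ _) f g g-const = begin
  length xs * (∑[ x ∈ xs ] (f x * g x))
    ≡⟨ cong (length xs *_) (∑-cong xs λ x → cong (f x *_) (g-const x x₀)) ⟩
  length xs * (∑[ x ∈ xs ] (f x * g x₀))
    ≡⟨ cong (length xs *_) (*-distribʳ-∑ (g x₀) xs f) ⟩
  length xs * (∑ xs f * g x₀)
    ≡⟨ m*[n*o]≡n*[m*o] (length xs) (∑ xs f) (g x₀) ⟩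
  ∑ xs f * (length xs * g x₀)
    ≡⟨ cong (∑ xs f *_) (trans (∑-cong xs λ x → g-const x x₀) (∑-const xs (g x₀))) ⟨
  ∑ xs f * ∑ xs g ∎
  where open ≡-Reasoning

-- Independence of one letter of a uniformly random word from the other letters.
∑-words-lookup : ∀ (xs : List A) {t} (i : Fin t) (f : A → ℕ) (F : Vec A t → ℕ) →
  (∀ w x → F (w [ i ]≔ x) ≡ F w) →
  length xs * (∑[ w ∈ words xs t ] (f (lookup w i) * F w)) ≡ ∑ xs f * ∑ (words xs t) F
∑-words-lookup xs {suc t} zero f F F-inv = begin
  length xs * (∑[ w ∈ words xs (suc t) ] (f (lookup w zero) * F w))
    ≡⟨ cong (length xs *_) (∑-cartesianProductWith _∷_ xs (words xs t) _) ⟩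
  length xs * (∑[ x ∈ xs ] ∑[ w ∈ words xs t ] (f x * F (x ∷ w)))
    ≡⟨ cong (length xs *_) (∑-cong xs λ x → *-distribˡ-∑ (f x) (words xs t) _) ⟩
  length xs * (∑[ x ∈ xs ] (f x * (∑[ w ∈ words xs t ] F (x ∷ w))))
    ≡⟨ ∑-*-constant xs f _ (λ x y → ∑-cong (words xs t) λ w → F-inv (y ∷ w) x) ⟩
  ∑ xs f * (∑[ x ∈ xs ] ∑[ w ∈ words xs t ] F (x ∷ w))
    ≡⟨ cong (∑ xs f *_) (∑-cartesianProductWith _∷_ xs (words xs t) F) ⟨
  ∑ xs f * ∑ (words xs (suc t)) F ∎
  where open ≡-Reasoning
∑-words-lookup xs {suc t} (suc i) f F F-inv = begin
  length xs * (∑[ w ∈ words xs (suc t) ] (f (lookup w (suc i)) * F w))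
    ≡⟨ cong (length xs *_) (∑-cartesianProductWith _∷_ xs (words xs t) _) ⟩
  length xs * (∑[ x ∈ xs ] ∑[ w ∈ words xs t ] (f (lookup w i) * F (x ∷ w)))
    ≡⟨ *-distribˡ-∑ (length xs) xs _ ⟨
  ∑[ x ∈ xs ] (length xs * (∑[ w ∈ words xs t ] (f (lookup w i) * F (x ∷ w))))
    ≡⟨ (∑-cong xs λ x →
         ∑-words-lookup xs i f (λ w → F (x ∷ w)) λ w → F-inv (x ∷ w)) ⟩
  ∑[ x ∈ xs ] (∑ xs f * (∑[ w ∈ words xs t ] F (x ∷ w)))
    ≡⟨ *-distribˡ-∑ (∑ xs f) xs _ ⟩
  ∑ xs f * (∑[ x ∈ xs ] ∑[ w ∈ words xs t ] F (x ∷ w))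
    ≡⟨ cong (∑ xs f *_) (∑-cartesianProductWith _∷_ xs (words xs t) F) ⟨
  ∑ xs f * ∑ (words xs (suc t)) F ∎
  where open ≡-Reasoning

-- The letter at `ι j` is independent of the remaining product, since `ι` is injective and `j` does
-- not recur in `js`; so `∑-words-lookup` splits off one factor at a time. Powers of `length xs` on
-- both sides replace division.
∑-words-∏ : ∀ (xs : List A) {t m} {js : List B} → Unique js →
  (ι : B → Fin t) → Injective _≡_ _≡_ ι →
  (f : B → A → ℕ) → (∀ j → ∑ xs (f j) ≤ m) →
  length xs ^ length js * (∑[ w ∈ words xs t ] ∏[ j ∈ js ] f j (lookup w (ι j)))
    ≤ m ^ length js * length xs ^ t
∑-words-∏ xs {t} [] ι ι-inj f f≤m = ≤-reflexive (cong (_+ 0)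
  (trans (∑-const (words xs t) 1) (trans (*-identityʳ _) (length-words xs t))))
∑-words-∏ xs {t} {m} {j ∷ js} (j∉js ∷ js!) ι ι-inj f f≤m = begin
  n * n ^ ℓ * (∑[ w ∈ words xs t ] (f j (lookup w (ι j)) * F w))
    ≡⟨ trans (*-assoc n _ _) (m*[n*o]≡n*[m*o] n (n ^ ℓ) _) ⟩
  n ^ ℓ * (n * (∑[ w ∈ words xs t ] (f j (lookup w (ι j)) * F w)))
    ≡⟨ cong (n ^ ℓ *_) (∑-words-lookup xs (ι j) (f j) F F-inv) ⟩
  n ^ ℓ * (∑ xs (f j) * ∑ (words xs t) F)
    ≡⟨ m*[n*o]≡n*[m*o] (n ^ ℓ) (∑ xs (f j)) _ ⟩
  ∑ xs (f j) * (n ^ ℓ * ∑ (words xs t) F)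
    ≤⟨ *-mono-≤ (f≤m j) (∑-words-∏ xs js! ι ι-inj f f≤m) ⟩
  m * (m ^ ℓ * n ^ t)
    ≡⟨ *-assoc m _ _ ⟨
  m * m ^ ℓ * n ^ t ∎
  where
  open ≤-Reasoning
  n = length xs
  ℓ = length js

  F : Vec _ t → ℕ
  F w = ∏[ j ∈ js ] f j (lookup w (ι j))

  F-inv : ∀ w x → F (w [ ι j ]≔ x) ≡ F w
  F-inv w x = ∏-cong-All (All.map (λ {j′} j≢j′ → cong (f j′)
    (lookup∘update′ (λ ιj′≡ιj → j≢j′ (sym (ι-inj ιj′≡ιj))) w x)) j∉js)

-- Indicators and double counting.

⟦_⟧ : Dec P → ℕ
⟦ yes _ ⟧ = 1
⟦ no  _ ⟧ = 0

⟦⟧≤1 : (P? : Dec P) → ⟦ P? ⟧ ≤ 1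
⟦⟧≤1 (yes _) = ≤-refl
⟦⟧≤1 (no  _) = z≤n

0<⟦⟧⁺ : (P? : Dec P) → P → 0 < ⟦ P? ⟧
0<⟦⟧⁺ (yes _) _ = ≤-refl
0<⟦⟧⁺ (no ¬p) p = contradiction p ¬p

∑⟦⟧≡0 : ∀ {P : Pred A ℓ₂} (P? : Decidable P) {xs} → All (¬_ ∘ P) xs → ∑[ x ∈ xs ] ⟦ P? x ⟧ ≡ 0
∑⟦⟧≡0 P? []                    = refl
∑⟦⟧≡0 P? (_∷_ {x = x} ¬px ¬ps) with P? x
... | yes px = contradiction px ¬px
... | no  _  = ∑⟦⟧≡0 P? ¬ps

∑⟦⟧≤1 : ∀ {P : Pred A ℓ₂} (P? : Decidable P) {xs} → Unique xs →
        (∀ {x y} → P x → P y → x ≡ y) → ∑[ x ∈ xs ] ⟦ P? x ⟧ ≤ 1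
∑⟦⟧≤1 P? []                         P-unique = z≤n
∑⟦⟧≤1 P? (_∷_ {x = x} x∉xs xs!) P-unique with P? x
... | yes px = ≤-reflexive (cong suc
  (∑⟦⟧≡0 P? (All.map (λ x≢y py → x≢y (P-unique px py)) x∉xs)))
... | no  _  = ∑⟦⟧≤1 P? xs! P-unique

-- `R` relates every `x` to some `y` satisfying `P`, and no `y` serves two values of `x`. Summing
-- the indicator of `R` in both orders compares the two counts.
double-count : ∀ {P : Pred B ℓ₃} (P? : Decidable P) {R : A → B → Set ℓ₃} (R? : ∀ x y → Dec (R x y))
  {xs : List A} (ys : List B) → Unique xs →
  (∀ x → ∃[ y ] y List.∈ ys × R x y) →
  (∀ {x x′ y} → R x y → R x′ y → x ≡ x′) →
  (∀ {x y} → R x y → P y) →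
  length xs ≤ ∑[ y ∈ ys ] ⟦ P? y ⟧
double-count P? R? {xs} ys xs! total unique R⇒P = begin
  length xs                              ≡⟨ trans (∑-const xs 1) (*-identityʳ _) ⟨
  ∑[ _ ∈ xs ] 1                          ≤⟨ ∑-mono xs hit ⟩
  ∑[ x ∈ xs ] ∑[ y ∈ ys ] ⟦ R? x y ⟧     ≡⟨ ∑-swap xs ys _ ⟩
  ∑[ y ∈ ys ] ∑[ x ∈ xs ] ⟦ R? x y ⟧     ≤⟨ ∑-mono ys once ⟩
  ∑[ y ∈ ys ] ⟦ P? y ⟧                   ∎
  where
  open ≤-Reasoning
  hit : ∀ x → 1 ≤ ∑[ y ∈ ys ] ⟦ R? x y ⟧
  hit x with y , y∈ys , Rxy ← total x =
    ≤-trans (0<⟦⟧⁺ (R? x y) Rxy) (∈⇒≤∑ (λ y → ⟦ R? x y ⟧) y∈ys)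

  once : ∀ y → ∑[ x ∈ xs ] ⟦ R? x y ⟧ ≤ ⟦ P? y ⟧
  once y with P? y
  ... | yes _ = ∑⟦⟧≤1 (λ x → R? x y) xs! unique
  ... | no ¬p = ≤-reflexive (∑⟦⟧≡0 (λ x → R? x y) (All.universal (λ x Rxy → ¬p (R⇒P Rxy)) xs))

-- Vertices, ordered pairs of vertices, and edges.

elements : ∀ {n} → Subset n → List (Fin n)
elements []            = []
elements (inside  ∷ s) = zero ∷ map suc (elements s)
elements (outside ∷ s) = map suc (elements s)

length-elements : ∀ {n} (s : Subset n) → length (elements s) ≡ ∣ s ∣
length-elements []            = refl
length-elements (inside  ∷ s) = cong suc (trans (length-map suc (elements s)) (length-elements s))
length-elements (outside ∷ s) = trans (length-map suc (elements s)) (length-elements s)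

∈-elements : ∀ {n x} {s : Subset n} → x ∈ s → x List.∈ elements s
∈-elements {s = inside  ∷ s} here        = here refl
∈-elements {s = inside  ∷ s} (there x∈s) = there (∈-map⁺ suc (∈-elements x∈s))
∈-elements {s = outside ∷ s} (there x∈s) = ∈-map⁺ suc (∈-elements x∈s)

elements-unique : ∀ {n} (s : Subset n) → Unique (elements s)
elements-unique []            = []
elements-unique (inside  ∷ s) =
  All.map⁺ (All.universal (λ _ ()) (elements s)) ∷ Unique.map⁺ suc-injective (elements-unique s)
elements-unique (outside ∷ s) = Unique.map⁺ suc-injective (elements-unique s)

vertices : Graph N → List (Fin N)
vertices G = elements (V G)

vertexPairs : Graph N → List (Fin N × Fin N)
vertexPairs G = cartesianProduct (vertices G) (vertices G)

length-vertexPairs : (G : Graph N) →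
  length (vertexPairs G) ≡ length (vertices G) * length (vertices G)
length-vertexPairs G = length-cartesianProductWith _,_ (vertices G) (vertices G)

vertexPairs-unique : (G : Graph N) → Unique (vertexPairs G)
vertexPairs-unique G = Unique.cartesianProduct⁺ (elements-unique (V G)) (elements-unique (V G))

~⇒∈vertices : (G : Graph N) → ∀ {x y} → _~_ G x y →
               x List.∈ vertices G × y List.∈ vertices G
~⇒∈vertices G x~y = ∈-elements (~⇒∈ G x~y) , ∈-elements (~⇒∈ G (~-sym G x~y))

-- Each edge is counted in both orientations, in agreement with the sampling of ordered pairs.
edgeCount : Graph N → ℕ
edgeCount G = ∑[ e ∈ vertexPairs G ] ⟦ uncurry (_~?_ G) e ⟧

-- Optimal colourings and the number of edges.

χ-colourable : (G : Graph N) → Colourable G (χ G)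
χ-colourable G = proj₁ (proj₂ (χ-least G))

χ≤ : (G : Graph N) → Colourable G k → χ G ≤ k
χ≤ G = proj₂ (proj₂ (χ-least G)) _

colourable-mono : ∀ (G : Graph N) {k l} → k ≤ l → Colourable G k → Colourable G l
colourable-mono G k≤l (c , c< , proper) = c , (λ x x∈V → ≤-trans (c< x x∈V) k≤l) , proper

-- Identifies the colours a and b, and moves the last colour h to the freed slot b.
merge : (a b h : ℕ) → ℕ → ℕ
merge a b h u with u ℕ.≟ b | u ℕ.≟ h
... | yes _ | _     = a
... | no  _ | yes _ = b
... | no  _ | no  _ = u

merge-< : ∀ {a b h} → a < b → b ≤ h → ∀ u → u ≤ h → merge a b h u < h
merge-< {a} {b} {h} a<b b≤h u u≤h with u ℕ.≟ b | u ℕ.≟ h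
... | yes _   | _        = ≤-trans a<b b≤h
... | no  u≢b | yes refl = ≤∧≢⇒< b≤h (u≢b ∘ sym)
... | no  _   | no  u≢h  = ≤∧≢⇒< u≤h u≢h

merge-injective : ∀ {a b} h → a < b → ∀ u v → merge a b h u ≡ merge a b h v →
                  u ≡ v ⊎ (u ≡ a × v ≡ b) ⊎ (v ≡ a × u ≡ b)
merge-injective {a} {b} h a<b u v eq with u ℕ.≟ b | u ℕ.≟ h | v ℕ.≟ b | v ℕ.≟ h
... | yes u≡b | _       | yes v≡b | _       = inj₁ (trans u≡b (sym v≡b))
... | yes _   | _       | no  _   | yes _   = contradiction eq (<⇒≢ a<b)
... | yes u≡b | _       | no  _   | no  _   = inj₂ (inj₂ (sym eq , u≡b))
... | no  _   | yes _   | yes _   | _       = contradiction (sym eq) (<⇒≢ a<b)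
... | no  _   | yes u≡h | no  _   | yes v≡h = inj₁ (trans u≡h (sym v≡h))
... | no  _   | yes _   | no  v≢b | no  _   = contradiction (sym eq) v≢b
... | no  _   | no  _   | yes v≡b | _       = inj₂ (inj₁ (eq , v≡b))
... | no  u≢b | no  _   | no  _   | yes _   = contradiction eq u≢b
... | no  _   | no  _   | no  _   | no  _   = inj₁ eq

-- Two colours without an edge between them can share one colour, which frees a colour; for an
-- optimal colouring this is impossible.
merge-colourable : ∀ (G : Graph N) {h c a b} → IsColouring G (suc h) c → a < b → b ≤ h →
  (∀ {x y} → _~_ G x y → ¬ (c x ≡ a × c y ≡ b)) → Colourable G h
merge-colourable G {h} {c} {a} {b} (c< , proper) a<b b≤h no-edge =
  merge a b h ∘ c , (λ x x∈V → merge-< a<b b≤h (c x) (s≤s⁻¹ (c< x x∈V))) , proper′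
  where
  proper′ : ∀ x y → _~_ G x y → merge a b h (c x) ≢ merge a b h (c y)
  proper′ x y x~y eq with merge-injective h a<b (c x) (c y) eq
  ... | inj₁ cx≡cy          = proper x y x~y cx≡cy
  ... | inj₂ (inj₁ colours) = no-edge x~y colours
  ... | inj₂ (inj₂ colours) = no-edge (~-sym G x~y) colours

-- In a colouring with χ colours, any two colour classes are joined by an edge.
edgeCount-lower-bound : (G : Graph N) → ∀ D → 2 * D ≤ χ G → D * D ≤ edgeCount G
edgeCount-lower-bound {N} G D 2D≤χ with χ G in χ≡ | χ-colourable G
... | zero  | _ rewrite n≤0⇒n≡0 (≤-trans (m≤m+n D _) 2D≤χ) = z≤n
... | suc h | c , c-col = begin
  D * D                          ≡⟨ cong₂ _*_ (length-allFin D) (length-allFin D) ⟨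
  length (allFin D) * length (allFin D)
    ≡⟨ length-cartesianProductWith _,_ (allFin D) (allFin D) ⟨
  length colourPairs
    ≤⟨ double-count (uncurry (_~?_ G)) coloured? (vertexPairs G)
         (Unique.cartesianProduct⁺ (Unique.allFin⁺ D) (Unique.allFin⁺ D)) joined
         (λ {p} {p′} {e} → unique {p} {p′} {e}) proj₁ ⟩
  edgeCount G ∎
  where
  open ≤-Reasoning
  colourPairs = cartesianProduct (allFin D) (allFin D)

  -- Only edges from a colour below `D` to a colour in the next `D` are used: the colours of such an
  -- edge recover `(i , j)`, and `i < D + j` always holds, as merging requires.
  Coloured : Fin D × Fin D → Fin N × Fin N → Set
  Coloured (i , j) (x , y) = _~_ G x y × c x ≡ toℕ i × c y ≡ D + toℕ j

  coloured? : ∀ p e → Dec (Coloured p e)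
  coloured? (i , j) (x , y) = _~?_ G x y ×-dec c x ℕ.≟ toℕ i ×-dec c y ℕ.≟ D + toℕ j

  unique : ∀ {p p′ e} → Coloured p e → Coloured p′ e → p ≡ p′
  unique (_ , cx , cy) (_ , cx′ , cy′) = cong₂ _,_
    (toℕ-injective (trans (sym cx) cx′))
    (toℕ-injective (+-cancelˡ-≡ D _ _ (trans (sym cy) cy′)))

  joined : ∀ p → ∃[ e ] e List.∈ vertexPairs G × Coloured p e
  joined p@(i , j) with any? (coloured? p) (vertexPairs G)
  ... | yes found = find found
  -- If no edge joins the two colours, merging them colours `G` with one colour fewer than `χ G`.
  ... | no  none  = contradiction (χ≤ G (merge-colourable G c-col i<D+j D+j≤h no-edge))
                                  (<⇒≱ (≤-reflexive (sym χ≡)))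
    where
    i<D+j : toℕ i < D + toℕ j
    i<D+j = ≤-trans (toℕ<n i) (m≤m+n D _)
    D+j≤h : D + toℕ j ≤ h
    D+j≤h = s≤s⁻¹ (≤-trans (+-monoʳ-< D (≤-trans (toℕ<n j) (m≤m+n D 0))) 2D≤χ)
    no-edge : ∀ {x y} → _~_ G x y → ¬ (c x ≡ toℕ i × c y ≡ D + toℕ j)
    no-edge x~y colours = let x∈ , y∈ = ~⇒∈vertices G x~y in
      none (List.lose (∈-cartesianProduct⁺ x∈ y∈) (x~y , colours))

-- Monochromatic subgraphs and the list of colourings.

monochromatic : Graph N → (Fin N → Fin k) → Graph N
monochromatic G g = record
  { V        = V G
  ; _~_      = λ x y → _~_ G x y × g x ≡ g y
  ; _~?_     = λ x y → _~?_ G x y ×-dec g x ≟ g y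
  ; ~-sym    = λ (x~y , gx≡gy) → ~-sym G x~y , sym gx≡gy
  ; ~-irrefl = λ x≡y (x~y , _) → ~-irrefl G x≡y x~y
  ; ~⇒∈      = ~⇒∈ G ∘ proj₁
  }

-- Pair the colour under `g` with the colour in an optimal colouring of the monochromatic subgraph.
-- The pairs colour `G` properly, because an edge whose ends agree under `g` survives in that
-- subgraph. They are encoded in base `h`.
χ≤k*χ-monochromatic : (G : Graph N) (g : Fin N → Fin k) →
                      χ G ≤ k * χ (monochromatic G g)
χ≤k*χ-monochromatic {N} {k} G g = χ≤ G (col , bounded , proper)
  where
  h = χ (monochromatic G g)
  c = proj₁ (χ-colourable (monochromatic G g))
  c< = proj₁ (proj₂ (χ-colourable (monochromatic G g)))
  c-proper = proj₂ (proj₂ (χ-colourable (monochromatic G g)))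

  col : Fin N → ℕ
  col x = h * toℕ (g x) + c x

  -- The colour `c x` is known to be below `h` only on the vertex set, so the encoding by `combine`
  -- is available only there.
  cᶠ : ∀ x → x ∈ V G → Fin h
  cᶠ x x∈V = fromℕ< (c< x x∈V)

  col≡ : ∀ x x∈V → toℕ (combine (g x) (cᶠ x x∈V)) ≡ col x
  col≡ x x∈V = trans (toℕ-combine (g x) (cᶠ x x∈V))
                     (cong (h * toℕ (g x) +_) (toℕ-fromℕ< (c< x x∈V)))

  bounded : ∀ x → x ∈ V G → col x < k * h
  bounded x x∈V = subst (_< k * h) (col≡ x x∈V) (toℕ<n (combine (g x) (cᶠ x x∈V)))

  proper : ∀ x y → _~_ G x y → col x ≢ col y
  proper x y x~y eq = c-proper x y (x~y , gx≡gy) cx≡cy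
    where
    x∈V = ~⇒∈ G x~y
    y∈V = ~⇒∈ G (~-sym G x~y)
    same = combine-injective (g x) (cᶠ x x∈V) (g y) (cᶠ y y∈V)
      (toℕ-injective (trans (col≡ x x∈V) (trans eq (sym (col≡ y y∈V)))))
    gx≡gy = proj₁ same
    cx≡cy = trans (sym (toℕ-fromℕ< (c< x x∈V)))
                  (trans (cong toℕ (proj₂ same)) (toℕ-fromℕ< (c< y y∈V)))

edgeCount-monochromatic : (G : Graph N) (g : Fin N → Fin (suc k)) → ∀ D →
  suc k * (2 * D) ≤ χ G → D * D ≤ edgeCount (monochromatic G g)
edgeCount-monochromatic {k = k} G g D le = edgeCount-lower-bound (monochromatic G g) D
  (*-cancelˡ-≤ (suc k) (≤-trans le (χ≤k*χ-monochromatic G g)))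

-- One representative for each colouring of the listed vertices; its values elsewhere
-- are irrelevant.
colourings : ∀ k → List (Fin N) → List (Fin N → Fin (suc k))
colourings k []       = (λ _ → zero) ∷ []
colourings k (x ∷ xs) =
  cartesianProductWith (λ i g → updateAt g x λ _ → i) (allFin (suc k)) (colourings k xs)

length-colourings : ∀ k (xs : List (Fin N)) → length (colourings k xs) ≡ suc k ^ length xs
length-colourings k []       = refl
length-colourings k (x ∷ xs) = trans
  (length-cartesianProductWith _ (allFin (suc k)) (colourings k xs))
  (cong₂ _*_ (length-allFin (suc k)) (length-colourings k xs))

colourings-complete : ∀ (c : Fin N → Fin (suc k)) (xs : List (Fin N)) →
  ∃[ g ] g List.∈ colourings k xs × (∀ {x} → x List.∈ xs → g x ≡ c x)
colourings-complete         c []       = (λ _ → zero) , here refl , λ ()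
colourings-complete {k = k} c (x ∷ xs) with g , g∈ , g≡c ← colourings-complete c xs =
  updateAt g x (λ _ → c x) ,
  ∈-cartesianProductWith⁺ _ (∈-allFin (c x)) g∈ ,
  agree
  where
  agree : ∀ {y} → y List.∈ x ∷ xs → updateAt g x (λ _ → c x) y ≡ c y
  agree {y} y∈ with y ≟ x
  agree y∈            | yes refl = updateAt-updates x g
  agree (here refl)   | no  y≢x  = contradiction refl y≢x
  agree {y} (there y∈xs) | no  y≢x  = trans (updateAt-minimal y x g y≢x) (g≡c y∈xs)

-- Cycles, and closed walks formed by sampled pairs.

next : Fin (suc l) → Fin (suc l)
next i with view i
... | ‵fromℕ     = zero
... | ‵inject₁ j = suc j

toℕ-next : (i : Fin (suc l)) →
           (toℕ i ≡ l × toℕ (next i) ≡ 0) ⊎ toℕ (next i) ≡ suc (toℕ i)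
toℕ-next i with view i
... | ‵fromℕ     = inj₁ (toℕ-fromℕ _ , refl)
... | ‵inject₁ j = inj₂ (cong suc (sym (toℕ-inject₁ j)))

-- Excludes that a cycle runs through one edge in both directions, the only way in which one sampled
-- pair could join two different steps of a cycle.
next-no-2-cycle : 3 ≤ suc l → ∀ {i j : Fin (suc l)} → next i ≡ j → next j ≡ i → ⊥
next-no-2-cycle {l} 3≤1+l {i} {j} refl next-j≡i with toℕ-next i | toℕ-next (next i)
... | inj₁ (i≡l , j≡0) | inj₁ (j≡l , _) = <⇒≱ 3≤1+l (s≤s (subst (_≤ 1) (trans (sym j≡0) j≡l) z≤n))
... | inj₁ (i≡l , j≡0) | inj₂ i≡1+j     = <⇒≱ 3≤1+l (s≤s (≤-reflexive
  (trans (sym i≡l) (trans (cong toℕ (sym next-j≡i)) (trans i≡1+j (cong suc j≡0))))))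
... | inj₂ j≡1+i | inj₁ (j≡l , i≡0)     = <⇒≱ 3≤1+l (s≤s (≤-reflexive
  (trans (sym j≡l) (trans j≡1+i (cong suc (trans (cong toℕ (sym next-j≡i)) i≡0))))))
... | inj₂ j≡1+i | inj₂ i≡1+j           = 1+n≰n (≤-trans (n≤1+n _) (≤-reflexive
  (sym (trans (cong toℕ (sym next-j≡i)) (trans i≡1+j (cong suc j≡1+i))))))

cycle-next : (G : Graph N) {c : Fin (suc l) → Fin N} → IsCycle G c →
             ∀ i → _~_ G (c i) (c (next i))
cycle-next G (_ , step , close) i with view i
... | ‵fromℕ     = close
... | ‵inject₁ j = step j

Joins : Fin N × Fin N → Fin N → Fin N → Set
Joins (u , v) x y = (u ≡ x × v ≡ y) ⊎ (u ≡ y × v ≡ x)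

joins? : ∀ (e : Fin N × Fin N) x y → Dec (Joins e x y)
joins? (u , v) x y = (u ≟ x ×-dec v ≟ y) ⊎-dec (u ≟ y ×-dec v ≟ x)

joins-same : ∀ {e : Fin N × Fin N} {x y x′ y′} → Joins e x y → Joins e x′ y′ →
             x ≡ x′ ⊎ (y ≡ x′ × x ≡ y′)
joins-same (inj₁ (refl , refl)) (inj₁ (refl , refl)) = inj₁ refl
joins-same (inj₁ (refl , refl)) (inj₂ (refl , refl)) = inj₂ (refl , refl)
joins-same (inj₂ (refl , refl)) (inj₁ (refl , refl)) = inj₂ (refl , refl)
joins-same (inj₂ (refl , refl)) (inj₂ (refl , refl)) = inj₁ refl

⟦⊎⟧≤ : ∀ {P Q : Set ℓ₁} (P? : Dec P) (Q? : Dec Q) → ⟦ P? ⊎-dec Q? ⟧ ≤ ⟦ P? ⟧ + ⟦ Q? ⟧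
⟦⊎⟧≤ (yes _) _       = s≤s z≤n
⟦⊎⟧≤ (no  _) (yes _) = ≤-refl
⟦⊎⟧≤ (no  _) (no  _) = z≤n

-- The two orientations of the pair `x`, `y` account for the bound; this is the 2 in the expected
-- number (2t/n)^l of closed walks.
∑-joins≤2 : ∀ {es : List (Fin N × Fin N)} → Unique es → ∀ x y → ∑[ e ∈ es ] ⟦ joins? e x y ⟧ ≤ 2
∑-joins≤2 {es = es} es! x y = begin
  ∑[ e ∈ es ] ⟦ joins? e x y ⟧
    ≤⟨ ∑-mono es (λ (u , v) → ⟦⊎⟧≤ (u ≟ x ×-dec v ≟ y) (u ≟ y ×-dec v ≟ x)) ⟩
  ∑[ e ∈ es ] (⟦ is? x y e ⟧ + ⟦ is? y x e ⟧)
    ≡⟨ ∑-distrib-+ es _ _ ⟩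
  (∑[ e ∈ es ] ⟦ is? x y e ⟧) + (∑[ e ∈ es ] ⟦ is? y x e ⟧)
    ≤⟨ +-mono-≤ (∑⟦⟧≤1 (is? x y) es! unique) (∑⟦⟧≤1 (is? y x) es! unique) ⟩
  2 ∎
  where
  open ≤-Reasoning
  is? : ∀ x y (e : Fin _ × Fin _) → Dec (proj₁ e ≡ x × proj₂ e ≡ y)
  is? x y (u , v) = u ≟ x ×-dec v ≟ y
  unique : ∀ {x y} {e e′ : Fin _ × Fin _} →
           proj₁ e ≡ x × proj₂ e ≡ y → proj₁ e′ ≡ x × proj₂ e′ ≡ y → e ≡ e′
  unique (refl , refl) (refl , refl) = refl

-- The letters of w at the distinct positions ι are the edges of the closed
-- walk v.
ClosedWalk : Vec (Fin N × Fin N) t → Vec (Fin N) (suc l) → Vec (Fin t) (suc l) → Set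
ClosedWalk w v ι =
  (∀ i j → lookup ι i ≡ lookup ι j → i ≡ j) ×
  (∀ j → Joins (lookup w (lookup ι j)) (lookup v j) (lookup v (next j)))

injective? : (ι : Vec (Fin t) l) → Dec (∀ i j → lookup ι i ≡ lookup ι j → i ≡ j)
injective? ι = Fin.all? λ i → Fin.all? λ j → lookup ι i ≟ lookup ι j →-dec i ≟ j

closedWalk? : ∀ (w : Vec (Fin N × Fin N) t) (v : Vec (Fin N) (suc l)) ι → Dec (ClosedWalk w v ι)
closedWalk? w v ι = injective? ι ×-dec Fin.all? λ j → joins? _ _ _

-- For distinct positions each step leaves at most two pairs for its letter, and the letters are
-- independent. If a position repeats, no walk is counted.
∑-closedWalk : (G : Graph N) (v : Vec (Fin N) (suc l)) (ι : Vec (Fin t) (suc l)) →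
  length (vertexPairs G) ^ suc l * (∑[ w ∈ words (vertexPairs G) t ] ⟦ closedWalk? w v ι ⟧)
    ≤ 2 ^ suc l * length (vertexPairs G) ^ t
∑-closedWalk {l = l} {t = t} G v ι with injective? ι
... | no  _   = ≤-trans
  (∑-bound (length (vertexPairs G) ^ suc l) (words (vertexPairs G) t)
    λ _ → ≤-reflexive (*-zeroʳ (length (vertexPairs G) ^ suc l)))
  (≤-trans (≤-reflexive (*-zeroʳ (length (words (vertexPairs G) t)))) z≤n)
... | yes inj = begin
  m ^ suc l * (∑[ w ∈ words es t ] ⟦ yes inj ×-dec Fin.all? (edge? w) ⟧)
    ≤⟨ *-monoʳ-≤ (m ^ suc l) (∑-mono (words es t) ⟦⟧≤∏) ⟩
  m ^ suc l * (∑[ w ∈ words es t ] ∏[ j ∈ js ] ⟦ edge? w j ⟧)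
    ≡⟨ cong (λ n → m ^ n * (∑[ w ∈ words es t ] ∏[ j ∈ js ] ⟦ edge? w j ⟧))
         (length-allFin (suc l)) ⟨
  m ^ length js * (∑[ w ∈ words es t ] ∏[ j ∈ js ] ⟦ edge? w j ⟧)
    ≤⟨ ∑-words-∏ es (Unique.allFin⁺ (suc l)) (lookup ι) (λ {i} {j} → inj i j) _
         (λ j → ∑-joins≤2 (vertexPairs-unique G) (lookup v j) (lookup v (next j))) ⟩
  2 ^ length js * m ^ t
    ≡⟨ cong (λ n → 2 ^ n * m ^ t) (length-allFin (suc l)) ⟩
  2 ^ suc l * m ^ t ∎
  where
  open ≤-Reasoning
  es = vertexPairs G
  m  = length es
  js = allFin (suc l)

  edge? : ∀ (w : Vec _ t) j → Dec (Joins (lookup w (lookup ι j)) (lookup v j) (lookup v (next j)))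
  edge? w j = joins? (lookup w (lookup ι j)) (lookup v j) (lookup v (next j))

  ⟦⟧≤∏ : ∀ w → ⟦ yes inj ×-dec Fin.all? (edge? w) ⟧ ≤ ∏[ j ∈ js ] ⟦ edge? w j ⟧
  ⟦⟧≤∏ w with Fin.all? (edge? w)
  ... | yes all = 0<∏ js (λ j → 0<⟦⟧⁺ (edge? w j) (all j))
  ... | no  _   = z≤n

hit? : ∀ (G : Graph N) (g : Fin N → Fin k) e →
       Dec (_~_ (monochromatic G g) (proj₁ e) (proj₂ e))
hit? G g (x , y) = _~?_ (monochromatic G g) x y

-- Exponential moments bound a count from above, so the lower bound on hits is reached through an
-- upper bound on misses.
hits misses : Graph N → (Fin N → Fin k) → Vec (Fin N × Fin N) t → ℕ
hits   {t = t} G g w = ∑[ i ∈ allFin t ] ⟦ hit? G g (lookup w i) ⟧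
misses {t = t} G g w = ∑[ i ∈ allFin t ] (1 ∸ ⟦ hit? G g (lookup w i) ⟧)

-- The subgraph left after the short closed walks are broken.

module _ (G : Graph N) (ρ : ℕ) where

  private
    vs = vertices G

  -- Each closed walk is charged to the position of its first letter, so deleting every letter at
  -- which a short one starts deletes at most `shortWalks` letters. Walks have length `suc l`;
  -- letting `l` range over `Fin ρ` covers the lengths from 1 to `ρ`.
  walksFrom : Vec (Fin N × Fin N) t → Fin t → ℕ → ℕ
  walksFrom {t} w i l =
    ∑[ v ∈ words vs (suc l) ] ∑[ ι ∈ words (allFin t) l ] ⟦ closedWalk? w v (i ∷ ι) ⟧

  shortWalksFrom : Vec (Fin N × Fin N) t → Fin t → ℕ
  shortWalksFrom w i = ∑[ l ∈ allFin ρ ] walksFrom w i (toℕ l)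

  shortWalks : Vec (Fin N × Fin N) t → ℕ
  shortWalks {t} w = ∑[ i ∈ allFin t ] shortWalksFrom w i

  -- A letter survives when `shortWalksFrom w i ≡ 0`. Adjacency in `G` is demanded as well, since
  -- letters are arbitrary pairs of vertices.
  sparse : Vec (Fin N × Fin N) t → Graph N
  sparse w = record
    { V        = V G
    ; _~_      = λ x y → _~_ G x y × ∃[ i ] shortWalksFrom w i ≡ 0 × Joins (lookup w i) x y
    ; _~?_     = λ x y → _~?_ G x y ×-dec
                   Fin.any? λ i → shortWalksFrom w i ℕ.≟ 0 ×-dec joins? (lookup w i) x y
    ; ~-sym    = λ (x~y , i , kept , joins) → ~-sym G x~y , i , kept , swap joins
    ; ~-irrefl = λ x≡y (x~y , _) → ~-irrefl G x≡y x~y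
    ; ~⇒∈      = ~⇒∈ G ∘ proj₁
    }

  sparse⊑ : ∀ (w : Vec (Fin N × Fin N) t) → sparse w ⊑ G
  sparse⊑ w = record { V-⊆ = id ; E-⊆ = proj₁ }

  -- Choose a surviving letter for each edge of the cycle. The chosen positions are distinct because
  -- the length is at least three, so they form a closed walk counted at the letter of the first
  -- edge, which therefore cannot have survived.
  sparse-acyclic : ∀ (w : Vec (Fin N × Fin N) t) (l : Fin ρ) → ¬ HasCycle (sparse w) (suc (toℕ l))
  sparse-acyclic {t} w l (3≤1+l , c , cyc@(c-inj , _)) = <⇒≱ counted (≤-reflexive not-counted)
    where
    edge : ∀ j → _~_ (sparse w) (c j) (c (next j))
    edge = cycle-next (sparse w) cyc

    ι : Fin (suc (toℕ l)) → Fin t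
    ι j = proj₁ (proj₂ (edge j))

    joins : ∀ j → Joins (lookup w (ι j)) (c j) (c (next j))
    joins j = proj₂ (proj₂ (proj₂ (edge j)))

    not-counted : shortWalksFrom w (ι zero) ≡ 0
    not-counted = proj₁ (proj₂ (proj₂ (edge zero)))

    ι-inj : ∀ i j → ι i ≡ ι j → i ≡ j
    ι-inj i j eq with joins-same (joins i) (subst (λ h → Joins (lookup w h) _ _) (sym eq) (joins j))
    ... | inj₁ ci≡cj = c-inj ci≡cj
    ... | inj₂ (cnexti≡cj , ci≡cnextj) =
      contradiction (c-inj (sym ci≡cnextj)) (next-no-2-cycle 3≤1+l (c-inj cnexti≡cj))

    walk : ClosedWalk w (tabulate c) (tabulate ι)
    walk = ι-inj′ , joins′
      where
      ι-inj′ : ∀ i j → lookup (tabulate ι) i ≡ lookup (tabulate ι) j → i ≡ j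
      ι-inj′ i j rewrite lookup∘tabulate ι i | lookup∘tabulate ι j = ι-inj i j

      joins′ : ∀ j → Joins (lookup w (lookup (tabulate ι) j))
                           (lookup (tabulate c) j) (lookup (tabulate c) (next j))
      joins′ j
        rewrite lookup∘tabulate ι j | lookup∘tabulate c j | lookup∘tabulate c (next j) = joins j

    counted : 0 < shortWalksFrom w (ι zero)
    counted = begin
      1 ≤⟨ 0<⟦⟧⁺ (closedWalk? w (tabulate c) (tabulate ι)) walk ⟩
      ⟦ closedWalk? w (tabulate c) (ι zero ∷ tabulate (ι ∘ suc)) ⟧
        ≤⟨ ∈⇒≤∑ (λ κ → ⟦ closedWalk? w (tabulate c) (ι zero ∷ κ) ⟧)
             (∈-words (tabulate (ι ∘ suc)) λ _ → ∈-allFin _) ⟩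
      ∑[ κ ∈ words (allFin t) (toℕ l) ] ⟦ closedWalk? w (tabulate c) (ι zero ∷ κ) ⟧
        ≤⟨ ∈⇒≤∑ (λ v → ∑[ κ ∈ words (allFin t) (toℕ l) ] ⟦ closedWalk? w v (ι zero ∷ κ) ⟧)
             (∈-words (tabulate c) λ j → subst (List._∈ vs) (sym (lookup∘tabulate c j))
                (proj₁ (~⇒∈vertices G (proj₁ (edge j))))) ⟩
      walksFrom w (ι zero) (toℕ l)
        ≤⟨ ∈⇒≤∑ (λ l → walksFrom w (ι zero) (toℕ l)) (∈-allFin l) ⟩
      shortWalksFrom w (ι zero) ∎
      where open ≤-Reasoning

  private
    ≤infimum : ∀ {P : ℕ → Set} m g → IsInfimum P g → (∀ l → P l → m ≤ l) → [ m ] ≤⁺ g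
    ≤infimum m [ g ] (Pg , _) m≤ = [ m≤ g Pg ]
    ≤infimum m ⊤⁺    _        m≤ = [ m ] ≤⊤⁺

  sparse-girth : ∀ (w : Vec (Fin N × Fin N) t) → [ suc ρ ] ≤⁺ girth (sparse w)
  sparse-girth w = ≤infimum (suc ρ) (girth (sparse w)) (proj₂ (girth-infimum (sparse w))) long
    where
    long : ∀ l → HasCycle (sparse w) l → suc ρ ≤ l
    long (suc l) cyc with l <? ρ
    ... | yes l<ρ = contradiction
      (subst (HasCycle (sparse w) ∘ suc) (sym (toℕ-fromℕ< l<ρ)) cyc)
      (sparse-acyclic w (fromℕ< l<ρ))
    ... | no  l≮ρ = s≤s (≮⇒≥ l≮ρ)

  -- A proper colouring agrees on `vs` with some listed `g`. Every hit of `g` must then be a deleted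
  -- letter, since a surviving one would be an edge with equal colours at its ends; so there are at
  -- most `shortWalks G ρ w` hits.
  sparse-uncolourable : ∀ k (w : Vec (Fin N × Fin N) t) →
    (∀ g → g List.∈ colourings k vs → shortWalks w < hits G g w) →
    ¬ Colourable (sparse w) (suc k)
  sparse-uncolourable {t} k w many (c , c< , proper)
    -- The colouring `c` is bounded only on the vertex set; reduction modulo `suc k` bounds it
    -- everywhere and changes nothing there.
    with g , g∈ , g≡ ← colourings-complete (λ x → c x mod suc k) vs =
    <⇒≱ (many g g∈) (∑-mono (allFin t) hit⇒removed)
    where
    toℕ-g : ∀ {x} → x List.∈ vs → c x < suc k → toℕ (g x) ≡ c x
    toℕ-g {x} x∈ cx< = trans (cong toℕ (g≡ x∈))
      (trans (toℕ-fromℕ< (m%n<n (c x) (suc k))) (m<n⇒m%n≡m cx<))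

    hit⇒removed : ∀ i → ⟦ hit? G g (lookup w i) ⟧ ≤ shortWalksFrom w i
    hit⇒removed i with hit? G g (lookup w i) | shortWalksFrom w i in kept
    ... | no  _ | _     = z≤n
    ... | yes _ | suc _ = s≤s z≤n
    ... | yes (x~y , gx≡gy) | zero =
      contradiction cx≡cy (proper _ _ (x~y , i , kept , inj₁ (refl , refl)))
      where
      x∈ = ~⇒∈vertices G x~y
      cx≡cy = trans (sym (toℕ-g (proj₁ x∈) (c< _ (~⇒∈ G x~y))))
        (trans (cong toℕ gx≡gy) (toℕ-g (proj₂ x∈) (c< _ (~⇒∈ G (~-sym G x~y)))))

-- Exponential inequalities and averaging.

bernoulli : ∀ p j → p ^ j * (p + j) ≤ p * suc p ^ j
bernoulli p zero    = ≤-reflexive (lemma p)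
  where
  lemma : ∀ p → 1 * (p + 0) ≡ p * 1
  lemma = solve-∀
bernoulli p (suc j) = begin
  p * p ^ j * (p + suc j)              ≤⟨ m≤m+n _ (p ^ j * j) ⟩
  p * p ^ j * (p + suc j) + p ^ j * j  ≡⟨ lemma p (p ^ j) j ⟩
  suc p * (p ^ j * (p + j))            ≤⟨ *-monoʳ-≤ (suc p) (bernoulli p j) ⟩
  suc p * (p * suc p ^ j)              ≡⟨ m*[n*o]≡n*[m*o] (suc p) p (suc p ^ j) ⟩
  p * (suc p * suc p ^ j)              ∎
  where
  open ≤-Reasoning
  lemma : ∀ p q j → p * q * (p + suc j) + q * j ≡ suc p * (q * (p + j))
  lemma = solve-∀

-- Bernoulli's inequality (1 + 1/p)^j ≥ 1 + j/p at j = p + 1, where the right side exceeds 2. The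
-- case p = 0 is separate because a factor p is cancelled.
2*p^[1+p]≤[1+p]^[1+p] : ∀ p → 2 * p ^ suc p ≤ suc p ^ suc p
2*p^[1+p]≤[1+p]^[1+p] zero        = z≤n
2*p^[1+p]≤[1+p]^[1+p] p@(suc _) = *-cancelˡ-≤-pos p (s≤s z≤n) (begin
  p * (2 * p ^ suc p)          ≤⟨ m≤m+n _ (p ^ suc p) ⟩
  p * (2 * p ^ suc p) + p ^ suc p ≡⟨ lemma p (p ^ suc p) ⟩
  p ^ suc p * (p + suc p)      ≤⟨ bernoulli p (suc p) ⟩
  p * suc p ^ suc p            ∎)
  where
  open ≤-Reasoning
  lemma : ∀ p q → p * (2 * q) + q ≡ q * (p + suc p)
  lemma = solve-∀

-- (1 − e/a)^q ≤ 1/2 as soon as e/a ≥ 1/q.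
halving : ∀ {y e a} p → y + e ≡ a → a ≤ suc p * e → 2 * y ^ suc p ≤ a ^ suc p
halving {y} {e} {a} p y+e≡a a≤qe = *-cancelˡ-≤-pos (q ^ q) (0<^ q (s≤s z≤n)) (begin
  q ^ q * (2 * y ^ q)  ≡⟨ m*[n*o]≡n*[m*o] (q ^ q) 2 (y ^ q) ⟩
  2 * (q ^ q * y ^ q)  ≡⟨ cong (2 *_) (^-distribʳ-* q y q) ⟨
  2 * (q * y) ^ q      ≤⟨ *-monoʳ-≤ 2 (^-monoˡ-≤ q qy≤pa) ⟩
  2 * (p * a) ^ q      ≡⟨ cong (2 *_) (^-distribʳ-* p a q) ⟩
  2 * (p ^ q * a ^ q)  ≡⟨ *-assoc 2 (p ^ q) (a ^ q) ⟨
  2 * p ^ q * a ^ q    ≤⟨ *-monoˡ-≤ (a ^ q) (2*p^[1+p]≤[1+p]^[1+p] p) ⟩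
  q ^ q * a ^ q        ∎)
  where
  open ≤-Reasoning
  q = suc p

  qy≤pa : q * y ≤ p * a
  qy≤pa = +-cancelʳ-≤ a _ _ (begin
    q * y + a      ≤⟨ +-monoʳ-≤ (q * y) a≤qe ⟩
    q * y + q * e  ≡⟨ *-distribˡ-+ q y e ⟨
    q * (y + e)    ≡⟨ cong (q *_) y+e≡a ⟩
    a + p * a      ≡⟨ +-comm a (p * a) ⟩
    p * a + a      ∎)

-- Averages a penalty that is linear in f and, as in Chernoff's bound, exponential in h.
first-moment : ∀ {A B : Set} (xs : List A) (ys : List B) (f : A → ℕ) (h : B → A → ℕ) {n t T} →
  0 < n → 0 < length xs → 4 * 2 ^ n * length ys ≤ 2 ^ T →
  2 * ∑ xs f ≤ n * length xs →
  (∀ y → 2 ^ T * (∑[ x ∈ xs ] 2 ^ h y x) ≤ 2 ^ t * length xs) →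
  ∃[ x ] f x < n × (∀ y → y List.∈ ys → n + h y x < t)
first-moment {A} xs ys f h {n} {t} {T} 0<n 0<|xs| T-large f-small h-small =
  let x , penalty<  = ∑<⇒∃< xs penalty (n * 2 ^ t) average in
  x , fx<n x penalty< , λ y → hyx< x penalty< y
  where
  open ≤-Reasoning
  m = length xs
  X = ∑ xs f
  Y = ∑[ y ∈ ys ] ∑[ x ∈ xs ] 2 ^ h y x

  -- Either defect, `f x ≥ n` or `n + h y x ≥ t` for a listed `y`, raises the penalty to at least
  -- `n * 2 ^ t`. On average the first term is at most half of this and the second at most a
  -- quarter.
  penalty : A → ℕ
  penalty x = 2 ^ t * f x + n * 2 ^ n * (∑[ y ∈ ys ] 2 ^ h y x)

  ∑penalty : ∑ xs penalty ≡ 2 ^ t * X + n * 2 ^ n * Y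
  ∑penalty = trans
    (∑-distrib-+ xs (λ x → 2 ^ t * f x) (λ x → n * 2 ^ n * (∑[ y ∈ ys ] 2 ^ h y x)))
    (cong₂ _+_ (*-distribˡ-∑ (2 ^ t) xs f)
      (trans (*-distribˡ-∑ (n * 2 ^ n) xs (λ x → ∑[ y ∈ ys ] 2 ^ h y x))
             (cong (n * 2 ^ n *_) (∑-swap xs ys (λ x y → 2 ^ h y x)))))

  lemma₁ : ∀ a b c → a * (4 * b * c) ≡ 4 * b * (a * c)
  lemma₁ = solve-∀
  lemma₂ : ∀ a b c d → 4 * a * (b * (c * d)) ≡ 4 * a * b * (c * d)
  lemma₂ = solve-∀
  lemma₃ : ∀ a b d x y → 2 * (a * x + d * b * y) ≡ a * (2 * x) + d * (2 * b * y)
  lemma₃ = solve-∀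
  lemma₄ : ∀ b c → 4 * b * c ≡ 2 * (2 * b * c)
  lemma₄ = solve-∀
  lemma₅ : ∀ a b c → a * (b * c) + b * (a * c) ≡ 2 * (c * (b * a))
  lemma₅ = solve-∀

  Y-bound : 4 * 2 ^ n * Y ≤ 2 ^ t * m
  Y-bound = *-cancelˡ-≤-pos (2 ^ T) (0<^ T (s≤s z≤n)) (begin
    2 ^ T * (4 * 2 ^ n * Y)               ≡⟨ lemma₁ (2 ^ T) (2 ^ n) Y ⟩
    4 * 2 ^ n * (2 ^ T * Y)               ≤⟨ *-monoʳ-≤ (4 * 2 ^ n) (∑-bound (2 ^ T) ys h-small) ⟩
    4 * 2 ^ n * (length ys * (2 ^ t * m)) ≡⟨ lemma₂ (2 ^ n) (length ys) (2 ^ t) m ⟩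
    4 * 2 ^ n * length ys * (2 ^ t * m)   ≤⟨ *-monoˡ-≤ (2 ^ t * m) T-large ⟩
    2 ^ T * (2 ^ t * m)                   ∎)

  0<2^t*m : 0 < 2 ^ t * m
  0<2^t*m = *-mono-≤ (0<^ {2} t (s≤s z≤n)) 0<|xs|

  Y-bound′ : 2 * 2 ^ n * Y < 2 ^ t * m
  Y-bound′ = *-cancelˡ-< 2 (2 * 2 ^ n * Y) (2 ^ t * m) (begin-strict
    2 * (2 * 2 ^ n * Y)  ≡⟨ lemma₄ (2 ^ n) Y ⟨
    4 * 2 ^ n * Y        ≤⟨ Y-bound ⟩
    2 ^ t * m            <⟨ m<m+n (2 ^ t * m) (≤-trans 0<2^t*m (m≤m+n _ 0)) ⟩
    2 * (2 ^ t * m)      ∎)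

  average : ∑ xs penalty < m * (n * 2 ^ t)
  average = *-cancelˡ-< 2 (∑ xs penalty) (m * (n * 2 ^ t)) (begin-strict
    2 * ∑ xs penalty
      ≡⟨ cong (2 *_) ∑penalty ⟩
    2 * (2 ^ t * X + n * 2 ^ n * Y)
      ≡⟨ lemma₃ (2 ^ t) (2 ^ n) n X Y ⟩
    2 ^ t * (2 * X) + n * (2 * 2 ^ n * Y)
      <⟨ +-mono-≤-< (*-monoʳ-≤ (2 ^ t) f-small) (*-monoʳ-< n {{>-nonZero 0<n}} Y-bound′) ⟩
    2 ^ t * (n * m) + n * (2 ^ t * m)
      ≡⟨ lemma₅ (2 ^ t) n m ⟩
    2 * (m * (n * 2 ^ t)) ∎)

  fx<n : ∀ x → penalty x < n * 2 ^ t → f x < n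
  fx<n x penalty< = *-cancelˡ-< (2 ^ t) (f x) n (begin-strict
    2 ^ t * f x  ≤⟨ m≤m+n _ _ ⟩
    penalty x    <⟨ penalty< ⟩
    n * 2 ^ t    ≡⟨ *-comm n (2 ^ t) ⟩
    2 ^ t * n    ∎)

  hyx< : ∀ x → penalty x < n * 2 ^ t → ∀ y → y List.∈ ys → n + h y x < t
  hyx< x penalty< y y∈ with n + h y x <? t
  ... | yes lt = lt
  ... | no  ≮t = contradiction penalty< (≤⇒≯ (begin
    n * 2 ^ t                  ≤⟨ *-monoʳ-≤ n (^-monoʳ-≤ 2 (≮⇒≥ ≮t)) ⟩
    n * 2 ^ (n + h y x)        ≡⟨ cong (n *_) (^-distribˡ-+-* 2 n (h y x)) ⟩
    n * (2 ^ n * 2 ^ h y x)    ≡⟨ *-assoc n (2 ^ n) (2 ^ h y x) ⟨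
    n * 2 ^ n * 2 ^ h y x      ≤⟨ *-monoʳ-≤ (n * 2 ^ n) (∈⇒≤∑ (λ y → 2 ^ h y x) y∈) ⟩
    n * 2 ^ n * (∑[ y ∈ ys ] 2 ^ h y x)  ≤⟨ m≤n+m _ _ ⟩
    penalty x                  ∎))

-- The expected number of short closed walks.

module _ (G : Graph N) (ρ : ℕ) where

  private
    vs  = vertices G
    es  = vertexPairs G
    n   = length vs
    m   = length es

  -- With L = l + 1 there are t · n^L · t^l choices of first position, vertices and further
  -- positions. Each is realised with probability at most (2/n²)^L, so the expectation is at most
  -- (2t/n)^L.
  ∑-walksFrom : ∀ l → 0 < n →
    n ^ suc l * (∑[ i ∈ allFin t ] ∑[ w ∈ words es t ] walksFrom G ρ w i l)
      ≤ (2 * t) ^ suc l * m ^ t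
  ∑-walksFrom {t} l 0<n = *-cancelˡ-≤-pos (n ^ L) (0<^ L 0<n) (begin
    n ^ L * (n ^ L * Z)
      ≡⟨ *-assoc (n ^ L) (n ^ L) Z ⟨
    n ^ L * n ^ L * Z
      ≡⟨ cong (_* Z) (trans (cong (_^ L) (length-vertexPairs G)) (^-distribʳ-* n n L)) ⟨
    m ^ L * Z
      ≤⟨ ∑-bound (m ^ L) (allFin t) from ⟩
    length (allFin t) * (length (words vs L) * (length (words (allFin t) l) * (2 ^ L * m ^ t)))
      ≡⟨ cong₂ _*_ (length-allFin t) (cong₂ _*_ (length-words vs L)
           (cong (_* (2 ^ L * m ^ t))
             (trans (length-words (allFin t) l) (cong (_^ l) (length-allFin t))))) ⟩
    t * (n ^ L * (t ^ l * (2 ^ L * m ^ t)))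
      ≡⟨ lemma t (n ^ L) (t ^ l) (2 ^ L) (m ^ t) ⟩
    n ^ L * (2 ^ L * (t * t ^ l) * m ^ t)
      ≡⟨ cong (λ x → n ^ L * (x * m ^ t)) (^-distribʳ-* 2 t L) ⟨
    n ^ L * ((2 * t) ^ L * m ^ t) ∎)
    where
    open ≤-Reasoning
    L = suc l
    Z = ∑[ i ∈ allFin t ] ∑[ w ∈ words es t ] walksFrom G ρ w i l
    lemma : ∀ t x y z u → t * (x * (y * (z * u))) ≡ x * (z * (t * y) * u)
    lemma = solve-∀

    from : ∀ i → m ^ L * (∑[ w ∈ words es t ] walksFrom G ρ w i l)
      ≤ length (words vs L) * (length (words (allFin t) l) * (2 ^ L * m ^ t))
    from i = begin
      m ^ L * (∑[ w ∈ words es t ] walksFrom G ρ w i l)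
        ≡⟨ cong (m ^ L *_) (trans (∑-swap (words es t) (words vs L) _)
             (∑-cong (words vs L) λ v → ∑-swap (words es t) (words (allFin t) l) _)) ⟩
      m ^ L * (∑[ v ∈ words vs L ] ∑[ ι ∈ words (allFin t) l ] ∑[ w ∈ words es t ]
        ⟦ closedWalk? w v (i ∷ ι) ⟧)
        ≤⟨ ∑-bound (m ^ L) (words vs L) (λ v → ∑-bound (m ^ L) (words (allFin t) l) λ ι →
             ∑-closedWalk G v (i ∷ ι)) ⟩
      length (words vs L) * (length (words (allFin t) l) * (2 ^ L * m ^ t)) ∎

  -- The hypothesis on `L` says that (2t/n)^L ≤ n/(2ρ); the ρ lengths together give an expectation
  -- of at most n/2.
  ∑-shortWalks : 0 < ρ → 0 < n → (∀ {L} → L ≤ ρ → 2 * ρ * (2 * t) ^ L ≤ n ^ L * n) →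
    2 * (∑[ w ∈ words es t ] shortWalks G ρ w) ≤ n * m ^ t
  ∑-shortWalks {t} 0<ρ 0<n few = *-cancelˡ-≤-pos ρ 0<ρ (begin
    ρ * (2 * (∑[ w ∈ words es t ] shortWalks G ρ w))
      ≡⟨ lemma ρ _ ⟩
    2 * ρ * (∑[ w ∈ words es t ] shortWalks G ρ w)
      ≡⟨ cong (2 * ρ *_) swapped ⟩
    2 * ρ * (∑[ l ∈ allFin ρ ] Z l)
      ≤⟨ ∑-bound (2 * ρ) (allFin ρ) Z-bound ⟩
    length (allFin ρ) * (n * m ^ t)
      ≡⟨ cong (_* (n * m ^ t)) (length-allFin ρ) ⟩
    ρ * (n * m ^ t) ∎)
    where
    open ≤-Reasoning
    lemma : ∀ p q → p * (2 * q) ≡ 2 * p * q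
    lemma = solve-∀

    Z : Fin ρ → ℕ
    Z l = ∑[ i ∈ allFin t ] ∑[ w ∈ words es t ] walksFrom G ρ w i (toℕ l)

    swapped : ∑[ w ∈ words es t ] shortWalks G ρ w ≡ ∑[ l ∈ allFin ρ ] Z l
    swapped = trans (∑-cong (words es t) λ w → ∑-swap (allFin t) (allFin ρ) _)
      (trans (∑-swap (words es t) (allFin ρ) _)
             (∑-cong (allFin ρ) λ l → ∑-swap (words es t) (allFin t) _))

    Z-bound : ∀ l → 2 * ρ * Z l ≤ n * m ^ t
    Z-bound l = *-cancelˡ-≤-pos (n ^ L) (0<^ L 0<n) (begin
      n ^ L * (2 * ρ * Z l)              ≡⟨ m*[n*o]≡n*[m*o] (n ^ L) (2 * ρ) (Z l) ⟩
      2 * ρ * (n ^ L * Z l)              ≤⟨ *-monoʳ-≤ (2 * ρ) (∑-walksFrom {t} (toℕ l) 0<n) ⟩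
      2 * ρ * ((2 * t) ^ L * m ^ t)      ≡⟨ *-assoc (2 * ρ) _ _ ⟨
      2 * ρ * (2 * t) ^ L * m ^ t        ≤⟨ *-monoˡ-≤ (m ^ t) (few (toℕ<n l)) ⟩
      n ^ L * n * m ^ t                  ≡⟨ *-assoc (n ^ L) n (m ^ t) ⟩
      n ^ L * (n * m ^ t)                ∎)
      where L = suc (toℕ l)

-- The exponential moment of the misses.

module _ (G : Graph N) where

  private
    es = vertexPairs G
    m  = length es

    missWeight : (Fin N → Fin k) → ℕ
    missWeight g = ∑[ e ∈ es ] 2 ^ (1 ∸ ⟦ hit? G g e ⟧)

  misses+hits : ∀ (g : Fin N → Fin k) (w : Vec (Fin N × Fin N) t) → misses G g w + hits G g w ≡ t
  misses+hits {t = t} g w = begin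
    misses G g w + hits G g w
      ≡⟨ ∑-distrib-+ (allFin t) _ _ ⟨
    ∑[ i ∈ allFin t ] (1 ∸ ⟦ hit? G g (lookup w i) ⟧ + ⟦ hit? G g (lookup w i) ⟧)
      ≡⟨ ∑-cong (allFin t) (λ i → m∸n+n≡m (⟦⟧≤1 (hit? G g (lookup w i)))) ⟩
    ∑[ _ ∈ allFin t ] 1
      ≡⟨ trans (∑-const (allFin t) 1) (trans (*-identityʳ _) (length-allFin t)) ⟩
    t ∎
    where open ≡-Reasoning

  missWeight+edgeCount : (g : Fin N → Fin k) →
                         missWeight g + edgeCount (monochromatic G g) ≡ 2 * m
  missWeight+edgeCount g = begin
    missWeight g + edgeCount (monochromatic G g)
      ≡⟨ ∑-distrib-+ es _ _ ⟨
    ∑[ e ∈ es ] (2 ^ (1 ∸ ⟦ hit? G g e ⟧) + ⟦ hit? G g e ⟧)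
      ≡⟨ ∑-cong es (λ e → two (hit? G g e)) ⟩
    ∑[ _ ∈ es ] 2
      ≡⟨ trans (∑-const es 2) (*-comm m 2) ⟩
    2 * m ∎
    where
    open ≡-Reasoning
    two : ∀ {P : Set} (P? : Dec P) → 2 ^ (1 ∸ ⟦ P? ⟧) + ⟦ P? ⟧ ≡ 2
    two (yes _) = refl
    two (no  _) = refl

  -- A letter has mean weight 2 - e/m, where e is the number of monochromatic pairs. Since e/(2m) ≥
  -- 1/(p + 1), `halving` gains a factor 2 for each block of `suc p` letters, and there are `T`
  -- blocks.
  ∑-misses : ∀ p T {D} (g : Fin N → Fin k) →
    D * D ≤ edgeCount (monochromatic G g) → 2 * m ≤ suc p * (D * D) →
    2 ^ T * (∑[ w ∈ words es (suc p * T) ] 2 ^ misses G g w) ≤ (2 * m) ^ (suc p * T)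
  ∑-misses p T g D²≤ 2m≤qD² = begin
    2 ^ T * (∑[ w ∈ words es τ ] 2 ^ misses G g w)
      ≡⟨ cong (2 ^ T *_) (∑-words-^ 2 (λ e → 1 ∸ ⟦ hit? G g e ⟧) es τ) ⟩
    2 ^ T * y ^ τ             ≡⟨ cong (2 ^ T *_) (^-*-assoc y (suc p) T) ⟨
    2 ^ T * (y ^ suc p) ^ T   ≡⟨ ^-distribʳ-* 2 (y ^ suc p) T ⟨
    (2 * y ^ suc p) ^ T       ≤⟨ ^-monoˡ-≤ T (halving p (missWeight+edgeCount g)
                                   (≤-trans 2m≤qD² (*-monoʳ-≤ (suc p) D²≤))) ⟩
    ((2 * m) ^ suc p) ^ T     ≡⟨ ^-*-assoc (2 * m) (suc p) T ⟩
    (2 * m) ^ τ               ∎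
    where
    open ≤-Reasoning
    τ = suc p * T
    y = missWeight g

module _ (G : Graph N) (ρ : ℕ) where

  private
    vs = vertices G
    es = vertexPairs G
    n  = length vs
    m  = length es

  -- `first-moment` leaves fewer than n short walks and, for every listed colouring, n + misses < t
  -- = misses + hits, hence more than n hits.
  good-sample : ∀ k T → 0 < n → 0 < m → 4 * 2 ^ n * suc k ^ n ≤ 2 ^ T →
    2 * (∑[ w ∈ words es t ] shortWalks G ρ w) ≤ n * m ^ t →
    (∀ (g : Fin N → Fin (suc k)) → 2 ^ T * (∑[ w ∈ words es t ] 2 ^ misses G g w) ≤ (2 * m) ^ t) →
    ∃[ w ] ∀ g → g List.∈ colourings k vs → shortWalks G ρ {t} w < hits G g w
  good-sample {t} k T 0<n 0<m T-large few-walks few-misses = w , many-hits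
    where
    ws = words es t
    cs = colourings k vs

    0<|ws| : 0 < length ws
    0<|ws| = subst (0 <_) (sym (length-words es t)) (0<^ t 0<m)

    T-large′ : 4 * 2 ^ n * length cs ≤ 2 ^ T
    T-large′ = ≤-trans (≤-reflexive (cong (4 * 2 ^ n *_) (length-colourings k vs))) T-large

    few-walks′ : 2 * ∑ ws (shortWalks G ρ) ≤ n * length ws
    few-walks′ = ≤-trans few-walks (≤-reflexive (cong (n *_) (sym (length-words es t))))

    few-misses′ : ∀ (g : Fin N → Fin (suc k)) →
                  2 ^ T * (∑[ w ∈ ws ] 2 ^ misses G g w) ≤ 2 ^ t * length ws
    few-misses′ g = ≤-trans (few-misses g) (≤-reflexive
      (trans (^-distribʳ-* 2 m t) (cong (2 ^ t *_) (sym (length-words es t)))))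

    sample : ∃[ w ] shortWalks G ρ {t} w < n × (∀ g → g List.∈ cs → n + misses G g w < t)
    sample = first-moment ws cs (shortWalks G ρ) (misses G) {n} {t} {T}
      0<n 0<|ws| T-large′ few-walks′ few-misses′

    w = proj₁ sample

    many-hits : ∀ g → g List.∈ cs → shortWalks G ρ w < hits G g w
    many-hits g g∈ = <-trans (proj₁ (proj₂ sample)) (+-cancelˡ-< (misses G g w) n (hits G g w)
      (subst₂ _<_ (+-comm n (misses G g w)) (sym (misses+hits G g w)) (proj₂ (proj₂ sample) g g∈)))

-- The number of samples.

record SampleSize (n D k : ℕ) : Set where
  field
    p T : ℕ
  samples = suc p * T
  field
    p-large  : 2 * (n * n) ≤ suc p * (D * D)
    T-large  : 4 * 2 ^ n * suc k ^ n ≤ 2 ^ T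
    n≤2t     : n ≤ 2 * samples
    2tD²≤    : 2 * samples * (D * D) ≤ 6 * (k + 4) * (n * (n * n))

sampleSize : ∀ {n D} k → 0 < D → D ≤ n → SampleSize n D k
sampleSize {n} {D} k 0<D D≤n = record
  { p = p ; T = T ; p-large = <⇒≤ p-large ; T-large = T-large ; n≤2t = n≤2t ; 2tD²≤ = 2tD²≤ }
  where
  open ≤-Reasoning
  instance
    D²≢0 : NonZero (D * D)
    D²≢0 = >-nonZero (*-mono-≤ 0<D 0<D)

  0<n : 0 < n
  0<n = ≤-trans 0<D D≤n

  p = 2 * (n * n) / (D * D)
  -- The part `k * n` pays for the `suc k ^ n` colourings through `suc k ≤ 2 ^ k`, and `4 * n` for
  -- the factor `4 * 2 ^ n`.
  T = (k + 4) * n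

  p-large : 2 * (n * n) < suc p * (D * D)
  p-large = begin-strict
    2 * (n * n)                              ≡⟨ m≡m%n+[m/n]*n (2 * (n * n)) (D * D) ⟩
    2 * (n * n) % (D * D) + p * (D * D)      <⟨ +-monoˡ-< _ (m%n<n (2 * (n * n)) (D * D)) ⟩
    D * D + p * (D * D)                      ∎

  k<2^k : ∀ k → suc k ≤ 2 ^ k
  k<2^k zero    = ≤-refl
  k<2^k (suc k) = begin
    1 + suc k          ≤⟨ +-mono-≤ (0<^ {2} k (s≤s z≤n)) (k<2^k k) ⟩
    2 ^ k + 2 ^ k      ≡⟨ cong (2 ^ k +_) (+-identityʳ (2 ^ k)) ⟨
    2 ^ suc k          ∎

  T-large : 4 * 2 ^ n * suc k ^ n ≤ 2 ^ T
  T-large = begin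
    4 * 2 ^ n * suc k ^ n          ≤⟨ *-monoʳ-≤ (4 * 2 ^ n) (^-monoˡ-≤ n (k<2^k k)) ⟩
    4 * 2 ^ n * (2 ^ k) ^ n        ≡⟨ cong₂ _*_ (^-distribˡ-+-* 2 2 n) (sym (^-*-assoc 2 k n)) ⟨
    2 ^ (2 + n) * 2 ^ (k * n)      ≡⟨ ^-distribˡ-+-* 2 (2 + n) (k * n) ⟨
    2 ^ (2 + n + k * n)            ≤⟨ ^-monoʳ-≤ 2 (+-monoˡ-≤ (k * n)
                                        (+-monoˡ-≤ n (+-mono-≤ 0<n (≤-trans 0<n (m≤m+n n n))))) ⟩
    2 ^ (n + (n + n) + n + k * n)  ≡⟨ cong (2 ^_) (lemma k n) ⟩
    2 ^ T                          ∎
    where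
    lemma : ∀ k n → n + (n + n) + n + k * n ≡ (k + 4) * n
    lemma = solve-∀

  n≤2t : n ≤ 2 * (suc p * T)
  n≤2t = begin
    n                                                ≤⟨ m≤m+n n (k * n + 3 * n) ⟩
    n + (k * n + 3 * n)                              ≡⟨ lemma k n ⟩
    T                                                ≤⟨ m≤m+n T (p * T) ⟩
    suc p * T                                        ≤⟨ m≤m+n (suc p * T) _ ⟩
    2 * (suc p * T)                                  ∎
    where
    lemma : ∀ k n → n + (k * n + 3 * n) ≡ (k + 4) * n
    lemma = solve-∀

  2tD²≤ : 2 * (suc p * T) * (D * D) ≤ 6 * (k + 4) * (n * (n * n))
  2tD²≤ = begin
    2 * (suc p * T) * (D * D)           ≡⟨ lemma (suc p) (k + 4) n (D * D) ⟩
    2 * ((k + 4) * n) * (suc p * (D * D))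
      -- Rounding down gives p D² ≤ 2n², and the extra block letter adds D² ≤ n².
      ≤⟨ *-monoʳ-≤ (2 * ((k + 4) * n)) (+-mono-≤ (*-mono-≤ D≤n D≤n)
           (m/n*n≤m (2 * (n * n)) (D * D))) ⟩
    2 * ((k + 4) * n) * (n * n + 2 * (n * n)) ≡⟨ lemma′ (k + 4) n ⟩
    6 * (k + 4) * (n * (n * n))         ∎
    where
    lemma : ∀ q c n d → 2 * (q * (c * n)) * d ≡ 2 * (c * n) * (q * d)
    lemma = solve-∀
    lemma′ : ∀ c n → 2 * (c * n) * (n * n + 2 * (n * n)) ≡ 6 * c * (n * (n * n))
    lemma′ = solve-∀

-- Here `s` stands for 2t and `d` for D². As `n ≤ s`, the power (s/n)^L is largest at L = σ + 1,
-- where s ≤ c n³/d reduces the claim to the comparison of n^(2σ+1) with d^(σ+1).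
few-short-walks : ∀ {n s d c} σ → 0 < n → 0 < d → n ≤ s → s * d ≤ c * (n * (n * n)) →
  2 * suc σ * c ^ suc σ * (n * (n * n) ^ σ) ≤ d ^ suc σ →
  ∀ {L} → L ≤ suc σ → 2 * suc σ * s ^ L ≤ n ^ L * n
few-short-walks {n} {s} {d} {c} σ 0<n 0<d n≤s sd≤ hyp {L} L≤ρ =
  *-cancelˡ-≤-pos (s ^ e) (0<^ e (≤-trans 0<n n≤s)) (begin
  s ^ e * (2 * ρ * s ^ L)   ≡⟨ m*[n*o]≡n*[m*o] (s ^ e) (2 * ρ) (s ^ L) ⟩
  2 * ρ * (s ^ e * s ^ L)   ≡⟨ cong (2 * ρ *_) (split s) ⟨
  2 * ρ * s ^ ρ             ≤⟨ top ⟩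
  n ^ ρ * n                 ≡⟨ cong (_* n) (split n) ⟩
  n ^ e * n ^ L * n         ≤⟨ *-monoˡ-≤ n (*-monoˡ-≤ (n ^ L) (^-monoˡ-≤ e n≤s)) ⟩
  s ^ e * n ^ L * n         ≡⟨ *-assoc (s ^ e) (n ^ L) n ⟩
  s ^ e * (n ^ L * n)       ∎)
  where
  open ≤-Reasoning
  ρ = suc σ
  e = ρ ∸ L
  split : ∀ x → x ^ ρ ≡ x ^ e * x ^ L
  split x = trans (cong (x ^_) (sym (m∸n+n≡m L≤ρ))) (^-distribˡ-+-* x e L)
  lemma : ∀ r x y z m → r * (x * (y * (m * z))) ≡ r * x * z * (y * m)
  lemma = solve-∀

  top : 2 * ρ * s ^ ρ ≤ n ^ ρ * n
  top = *-cancelˡ-≤-pos (d ^ ρ) (0<^ ρ 0<d) (begin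
    d ^ ρ * (2 * ρ * s ^ ρ)
      ≡⟨ m*[n*o]≡n*[m*o] (d ^ ρ) (2 * ρ) (s ^ ρ) ⟩
    2 * ρ * (d ^ ρ * s ^ ρ)
      ≡⟨ cong (2 * ρ *_) (trans (*-comm (d ^ ρ) (s ^ ρ)) (sym (^-distribʳ-* s d ρ))) ⟩
    2 * ρ * (s * d) ^ ρ
      ≤⟨ *-monoʳ-≤ (2 * ρ) (^-monoˡ-≤ ρ sd≤) ⟩
    2 * ρ * (c * (n * (n * n))) ^ ρ
      ≡⟨ cong (2 * ρ *_) (trans (^-distribʳ-* c (n * (n * n)) ρ)
           (cong (c ^ ρ *_) (^-distribʳ-* n (n * n) ρ))) ⟩
    2 * ρ * (c ^ ρ * (n ^ ρ * ((n * n) * (n * n) ^ σ)))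
      ≡⟨ cong (λ x → 2 * ρ * (c ^ ρ * (n ^ ρ * x))) (*-assoc n n _) ⟩
    2 * ρ * (c ^ ρ * (n ^ ρ * (n * (n * (n * n) ^ σ))))
      ≡⟨ lemma (2 * ρ) (c ^ ρ) (n ^ ρ) (n * (n * n) ^ σ) n ⟩
    2 * ρ * c ^ ρ * (n * (n * n) ^ σ) * (n ^ ρ * n)
      ≤⟨ *-monoˡ-≤ (n ^ ρ * n) hyp ⟩
    d ^ ρ * (n ^ ρ * n) ∎)

-- From order and chromatic number to a sparse subgraph.

sparse-subgraph : ∀ (G : Graph N) k σ D → 0 < D → suc k * (2 * D) ≤ χ G →
  let n = length (vertices G) in
  2 * suc σ * (6 * (k + 4)) ^ suc σ * (n * (n * n) ^ σ) ≤ (D * D) ^ suc σ →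
  ∃[ H ] (H ⊑ G × [ suc (suc σ) ] ≤⁺ girth H × suc (suc k) ≤ χ H)
sparse-subgraph {N} G k σ D 0<D D≤χ hyp =
  sparse G ρ w , sparse⊑ G ρ w , sparse-girth G ρ w ,
  ≰⇒> λ χ≤ → sparse-uncolourable G ρ k w (proj₂ sample)
    (colourable-mono (sparse G ρ w) χ≤ (χ-colourable (sparse G ρ w)))
  where
  ρ = suc σ
  n = length (vertices G)
  m = length (vertexPairs G)

  D²≤ : ∀ (g : Fin N → Fin (suc k)) → D * D ≤ edgeCount (monochromatic G g)
  D²≤ g = edgeCount-monochromatic G g D D≤χ

  -- Under a constant colouring every edge is monochromatic, so D² is at most the number n² of
  -- ordered pairs.
  D≤n : D ≤ n
  D≤n = ^-cancelˡ-≤ 2 (s≤s z≤n) (begin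
    D * (D * 1)  ≡⟨ cong (D *_) (*-identityʳ D) ⟩
    D * D        ≤⟨ D²≤ g₀ ⟩
    edgeCount (monochromatic G g₀)
                 ≤⟨ ∑-mono (vertexPairs G) (λ e → ⟦⟧≤1 (hit? G g₀ e)) ⟩
    ∑[ _ ∈ vertexPairs G ] 1
                 ≡⟨ trans (∑-const (vertexPairs G) 1) (*-identityʳ m) ⟩
    m            ≡⟨ length-vertexPairs G ⟩
    n * n        ≡⟨ cong (n *_) (*-identityʳ n) ⟨
    n * (n * 1)  ∎)
    where
    open ≤-Reasoning
    g₀ : Fin N → Fin (suc k)
    g₀ _ = zero

  0<n : 0 < n
  0<n = ≤-trans 0<D D≤n

  open SampleSize (sampleSize k 0<D D≤n)

  sample : ∃[ w ] ∀ g → g List.∈ colourings k (vertices G) → shortWalks G ρ {samples} w < hits G g w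
  sample = good-sample G ρ k T 0<n
    (subst (0 <_) (sym (length-vertexPairs G)) (*-mono-≤ 0<n 0<n))
    T-large
    (∑-shortWalks G ρ {samples} (s≤s z≤n) 0<n
      (few-short-walks {d = D * D} {c = 6 * (k + 4)} σ 0<n (*-mono-≤ 0<D 0<D) n≤2t 2tD²≤ hyp))
    (λ g → ∑-misses G p T {D} g (D²≤ g)
      (subst (λ x → 2 * x ≤ suc p * (D * D)) (sym (length-vertexPairs G)) p-large))

  w = proj₁ sample

-- With D = m/(2(k + 1)) rounded down and positive, m ≤ 4(k + 1)D, so D is traded for m at the cost
-- of a constant. What remains compares n^(2ρ-1) with m^(2ρ); for ρ = r - 1 the ratio of the
-- exponents is the threshold (2r - 2)/(2r - 3).
dense⇒sparse-subgraph : ∀ (G : Graph N) k σ → let n = length (vertices G) ; m = χ G in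
  suc k * 2 ≤ m →
  2 * suc σ * (6 * (k + 4)) ^ suc σ * (suc k * 4) ^ (2 * suc σ) * n ^ (2 * σ + 1)
    ≤ m ^ (2 * suc σ) →
  ∃[ H ] (H ⊑ G × [ suc (suc σ) ] ≤⁺ girth H × suc (suc k) ≤ χ H)
dense⇒sparse-subgraph G k σ 2k≤m hyp = sparse-subgraph G k σ D 0<D (begin
    suc k * (2 * D)  ≡⟨ *-assoc (suc k) 2 D ⟨
    suc k * 2 * D    ≡⟨ *-comm (suc k * 2) D ⟩
    D * (suc k * 2)  ≤⟨ m/n*n≤m m (suc k * 2) ⟩
    m                ∎)
  (*-cancelˡ-≤-pos (κ ^ (2 * ρ)) (0<^ (2 * ρ) (s≤s z≤n)) (begin
    κ ^ (2 * ρ) * (C * (n * (n * n) ^ σ))  ≡⟨ cong (λ x → κ ^ (2 * ρ) * (C * x)) n^≡ ⟨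
    κ ^ (2 * ρ) * (C * n ^ (2 * σ + 1))    ≡⟨ lemma (κ ^ (2 * ρ)) C (n ^ (2 * σ + 1)) ⟩
    C * κ ^ (2 * ρ) * n ^ (2 * σ + 1)      ≤⟨ hyp ⟩
    m ^ (2 * ρ)                            ≤⟨ ^-monoˡ-≤ (2 * ρ) m≤κD ⟩
    (κ * D) ^ (2 * ρ)                      ≡⟨ ^-distribʳ-* κ D (2 * ρ) ⟩
    κ ^ (2 * ρ) * D ^ (2 * ρ)              ≡⟨ cong (κ ^ (2 * ρ) *_) (square-^ D ρ) ⟩
    κ ^ (2 * ρ) * (D * D) ^ ρ              ∎))
  where
  open ≤-Reasoning
  ρ = suc σ
  n = length (vertices G)
  m = χ G
  κ = suc k * 4
  C = 2 * ρ * (6 * (k + 4)) ^ ρ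
  D = m / (suc k * 2)

  square-^ : ∀ x e → x ^ (2 * e) ≡ (x * x) ^ e
  square-^ x e = trans (sym (^-*-assoc x 2 e)) (cong (λ y → (x * y) ^ e) (*-identityʳ x))

  n^≡ : n ^ (2 * σ + 1) ≡ n * (n * n) ^ σ
  n^≡ = trans (cong (n ^_) (+-comm (2 * σ) 1)) (cong (n *_) (square-^ n σ))

  lemma : ∀ a b c → a * (b * c) ≡ b * a * c
  lemma = solve-∀

  m<[1+D] : m < suc k * 2 + D * (suc k * 2)
  m<[1+D] = begin-strict
    m                                        ≡⟨ m≡m%n+[m/n]*n m (suc k * 2) ⟩
    m % (suc k * 2) + D * (suc k * 2)        <⟨ +-monoˡ-< (D * (suc k * 2)) (m%n<n m (suc k * 2)) ⟩
    suc k * 2 + D * (suc k * 2)              ∎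

  0<D : 0 < D
  0<D = ≮⇒≥ λ D<1 → <⇒≱ m<[1+D] (begin
    suc k * 2 + D * (suc k * 2)  ≡⟨ cong (λ d → suc k * 2 + d * (suc k * 2)) (n<1⇒n≡0 D<1) ⟩
    suc k * 2 + 0                ≡⟨ +-identityʳ _ ⟩
    suc k * 2                    ≤⟨ 2k≤m ⟩
    m                            ∎)

  m≤κD : m ≤ κ * D
  m≤κD = begin
    m                                  ≤⟨ <⇒≤ m<[1+D] ⟩
    suc k * 2 + D * (suc k * 2)        ≤⟨ +-monoˡ-≤ _ (m≤n*m (suc k * 2) D {{>-nonZero 0<D}}) ⟩
    D * (suc k * 2) + D * (suc k * 2)  ≡⟨ lemma′ D (suc k) ⟩
    κ * D                              ∎
    where
    lemma′ : ∀ d c → d * (c * 2) + d * (c * 2) ≡ c * 4 * d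
    lemma′ = solve-∀

-- After raising to the power `d`, the strict inequality `a * s < p * d` between integers leaves a
-- whole factor `m` to spare, which absorbs the constants.
power-gap : ∀ {n m c C d a} p s → 0 < d → 0 < m → a * s < p * d →
  n ^ d ≤ c ^ d * m ^ a → C ^ d * c ^ (d * s) ≤ m → C * n ^ s ≤ m ^ p
power-gap {n} {m} {c} {C} {d} {a} p s 0<d 0<m as<pd n^d≤ m-large = ^-cancelˡ-≤ d 0<d (begin
  (C * n ^ s) ^ d                      ≡⟨ ^-distribʳ-* C (n ^ s) d ⟩
  C ^ d * (n ^ s) ^ d                  ≡⟨ cong (C ^ d *_) (^-swap n s d) ⟩
  C ^ d * (n ^ d) ^ s                  ≤⟨ *-monoʳ-≤ (C ^ d) (^-monoˡ-≤ s n^d≤) ⟩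
  C ^ d * (c ^ d * m ^ a) ^ s          ≡⟨ cong (C ^ d *_) (^-distribʳ-* (c ^ d) (m ^ a) s) ⟩
  C ^ d * ((c ^ d) ^ s * (m ^ a) ^ s)  ≡⟨ cong (C ^ d *_)
                                            (cong₂ _*_ (^-*-assoc c d s) (^-*-assoc m a s)) ⟩
  C ^ d * (c ^ (d * s) * m ^ (a * s))  ≡⟨ *-assoc (C ^ d) _ _ ⟨
  C ^ d * c ^ (d * s) * m ^ (a * s)    ≤⟨ *-monoˡ-≤ (m ^ (a * s)) m-large ⟩
  m ^ suc (a * s)                      ≤⟨ ^-monoʳ-≤ m {{>-nonZero 0<m}} as<pd ⟩
  m ^ (p * d)                          ≡⟨ ^-*-assoc m p d ⟨
  (m ^ p) ^ d                          ∎)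
  where
  open ≤-Reasoning
  ^-swap : ∀ x i j → (x ^ i) ^ j ≡ (x ^ j) ^ i
  ^-swap x i j = trans (^-*-assoc x i j) (trans (cong (x ^_) (*-comm i j)) (sym (^-*-assoc x j i)))

-- Rational and real bounds as inequalities between natural numbers.

fromℕ→ℚ≡ : ∀ n → fromℕ→ℚ n ≡ mkℚ (ℤ.+ n) 0 (coprime-sym (1-coprimeTo n))
fromℕ→ℚ≡ n = ℚ.normalize-coprime _

fromℕ→ℚ-* : ∀ m n → fromℕ→ℚ (m * n) ≡ fromℕ→ℚ m ℚ.* fromℕ→ℚ n
fromℕ→ℚ-* m n rewrite fromℕ→ℚ≡ m | fromℕ→ℚ≡ n = cong (λ i → i ℚ./ 1) (ℤ.pos-* m n)

fromℕ→ℚ-^ : ∀ m e → fromℕ→ℚ (m ^ e) ≡ fromℕ→ℚ m ℚ^.^ e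
fromℕ→ℚ-^ m zero    = refl
fromℕ→ℚ-^ m (suc e) = trans (fromℕ→ℚ-* m (m ^ e)) (cong (fromℕ→ℚ m ℚ.*_) (fromℕ→ℚ-^ m e))

fromℕ→ℚ-cancel-≤ : ∀ {m n} → fromℕ→ℚ m ℚ.≤ fromℕ→ℚ n → m ≤ n
fromℕ→ℚ-cancel-≤ {m} {n} le rewrite fromℕ→ℚ≡ m | fromℕ→ℚ≡ n =
  ℤ.drop‿+≤+ (subst₂ ℤ._≤_ (ℤ.*-identityʳ (ℤ.+ m)) (ℤ.*-identityʳ (ℤ.+ n)) (ℚ.drop-*≤* le))

-- The denominator is at least one, so dividing by it cannot increase the absolute value.
<fromℕ→ℚ : ∀ b → b ℚ.< fromℕ→ℚ (suc ℤ.∣ ℚ.↥ b ∣)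
<fromℕ→ℚ b@(mkℚ i d-1 _) rewrite fromℕ→ℚ≡ (suc ℤ.∣ i ∣) =
  ℚ.*<* (subst₂ ℤ._<_ (sym (ℤ.*-identityʳ i)) (ℤ.pos-* (suc ℤ.∣ i ∣) (suc d-1)) (below i))
  where
  below : ∀ i → i ℤ.< ℤ.+ (suc ℤ.∣ i ∣ * suc d-1)
  below (ℤ.+ u)    = ℤ.+<+ (m≤m*n (suc u) (suc d-1))
  below ℤ.-[1+ u ] = ℤ.-<+

-- The fraction `p / s` need not be in lowest terms, so the cross-multiplication passes through
-- unnormalised rationals.
</⇒*< : ∀ {a d-1} .{a⊥d : Coprime a (suc d-1)} p s .{{_ : NonZero s}} →
        mkℚ (ℤ.+ a) d-1 a⊥d ℚ.< (ℤ.+ p) ℚ./ s → a * s < p * suc d-1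
</⇒*< {a} {d-1} p s@(suc s-1) lt = ℤ.drop‿+<+ (subst₂ ℤ._<_
  (sym (ℤ.pos-* a s)) (sym (ℤ.pos-* p (suc d-1)))
  (ℚᵘ.drop-*<* (ℚᵘ.<-respʳ-≃ (ℚ.toℚᵘ-fromℚᵘ (mkℚᵘ (ℤ.+ p) s-1)) (ℚ.toℚᵘ-mono-< lt))))

fromℕ→ℚ-^*^ : ∀ m d n e →
  fromℕ→ℚ (m ^ d * n ^ e) ≡ (fromℕ→ℚ m ℚ^.^ d) ℚ.* (fromℕ→ℚ n ℚ^.^ e)
fromℕ→ℚ-^*^ m d n e =
  trans (fromℕ→ℚ-* (m ^ d) (n ^ e)) (cong₂ ℚ._*_ (fromℕ→ℚ-^ m d) (fromℕ→ℚ-^ n e))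

natural-upper-bound : ∀ B → ∃[ c ] ℝ.U B (fromℕ→ℚ c)
natural-upper-bound B = let b , Bb = ℝ.U-inhabited B in
  suc ℤ.∣ ℚ.↥ b ∣ , ℝ.U-upper B (<fromℕ→ℚ b) Bb

-- The exponent a / d is a rational between β and p / s, or 0 where that one is negative.
rational-bound : ∀ B β p s .{{_ : NonZero s}} → 0 < p → β <ʳ fromℚ ((ℤ.+ p) ℚ./ s) →
  ∃[ c ] ∃[ d ] ∃[ a ] 0 < d × a * s < p * d ×
    (∀ n m → 0 < m → n ≤ℝ[ B · m ^ β ] → n ^ d ≤ c ^ d * m ^ a)
rational-bound B β p s 0<p (e , βe , e<p/s) with natural-upper-bound B
rational-bound B β p s 0<p (e@(mkℚ (ℤ.+ a) d-1 _) , βe , e<p/s) | c , Bc =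
  c , d , a , s≤s z≤n , </⇒*< p s e<p/s , λ n m 0<m n≤ →
    fromℕ→ℚ-cancel-≤ (subst₂ ℚ._≤_ (sym (fromℕ→ℚ-^ n d)) (sym (fromℕ→ℚ-^*^ c d m a))
      (n≤ (fromℕ→ℚ c) e Bc βe))
  where d = suc d-1
rational-bound B β p s 0<p (e@(mkℚ ℤ.-[1+ a ] d-1 _) , βe , e<p/s) | c , Bc =
  c , d , 0 , s≤s z≤n , *-mono-≤ 0<p (s≤s z≤n) , bound
  where
  open ≤-Reasoning
  d = suc d-1
  bound : ∀ n m → 0 < m → n ≤ℝ[ B · m ^ β ] → n ^ d ≤ c ^ d * m ^ 0
  bound n m 0<m n≤ = begin
    n ^ d              ≤⟨ m≤m*n (n ^ d) (m ^ suc a) {{>-nonZero (0<^ (suc a) 0<m)}} ⟩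
    n ^ d * m ^ suc a  ≤⟨ fromℕ→ℚ-cancel-≤ (subst₂ ℚ._≤_
                            (sym (fromℕ→ℚ-^*^ n d m (suc a))) (sym (fromℕ→ℚ-^ c d))
                            (n≤ (fromℕ→ℚ c) e Bc βe)) ⟩
    c ^ d              ≡⟨ *-identityʳ (c ^ d) ⟨
    c ^ d * 1          ∎

⊑-trans : {F G H : Graph N} → F ⊑ G → G ⊑ H → F ⊑ H
⊑-trans F⊑G G⊑H = record
  { V-⊆ = _⊑_.V-⊆ G⊑H ∘ _⊑_.V-⊆ F⊑G
  ; E-⊆ = _⊑_.E-⊆ G⊑H ∘ _⊑_.E-⊆ F⊑G
  }

theorem1p5 : (r k : ℕ) (4≤r : 4 ≤ r) → 2 ≤ k →
    (B β : ℝ) → 0ℝ <ʳ B → β <ʳ fromℚ (threshold r 4≤r) →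
    ∃[ M ] (∀ {N : ℕ} (G J : Graph N) (m : ℕ) →
    J ⊑ G → χ J ≡ m → m ≥ M → ∣ Graph.V J ∣ ≤ℝ[ B · m ^ β ] →
    ∃[ H ] (H ⊑ G × [ r ] ≤⁺ girth H × χ H ≥ k))
-- `suc σ` is r - 1, the greatest cycle length to be destroyed. The bound variable `k` is two below
-- the given number, so `suc k` colours must not suffice.
theorem1p5 r@(suc (suc σ)) (suc (suc k)) 4≤r@(s≤s (s≤s (s≤s (s≤s _)))) (s≤s (s≤s _)) B β _ β<thr
  with c , d , a , 0<d , as<pd , bound ←
         rational-bound B β (2 * r ∸ 2) (2 * r ∸ 3) (s≤s z≤n) β<thr = M , conclusion
  where
  C = 2 * suc σ * (6 * (k + 4)) ^ suc σ * (suc k * 4) ^ (2 * suc σ)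
  s = 2 * σ + 1

  -- The first summand makes the rounded quotient `D` positive; the second is the lower bound on `m`
  -- that `power-gap` requires.
  M = suc k * 2 + C ^ d * c ^ (d * s)

  s≡ : 2 * r ∸ 3 ≡ s
  s≡ = trans (cong (_∸ 3) (lemma σ)) (m+n∸m≡n 3 s)
    where
    lemma : ∀ σ → 2 * (2 + σ) ≡ 3 + (2 * σ + 1)
    lemma = solve-∀

  p≡ : 2 * r ∸ 2 ≡ 2 * suc σ
  p≡ = trans (cong (_∸ 2) (lemma σ)) (m+n∸m≡n 2 (2 * suc σ))
    where
    lemma : ∀ σ → 2 * (2 + σ) ≡ 2 + 2 * suc σ
    lemma = solve-∀

  conclusion : ∀ {N : ℕ} (G J : Graph N) (m : ℕ) →
    J ⊑ G → χ J ≡ m → m ≥ M → ∣ Graph.V J ∣ ≤ℝ[ B · m ^ β ] →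
    ∃[ H ] (H ⊑ G × [ r ] ≤⁺ girth H × χ H ≥ suc (suc k))
  conclusion G J m J⊑G refl m≥M small =
    let H , H⊑J , girth≥ , χ≥ = dense⇒sparse-subgraph J k σ (≤-trans (m≤m+n _ _) m≥M) dense
    in H , ⊑-trans H⊑J J⊑G , girth≥ , χ≥
    where
    0<m : 0 < m
    0<m = ≤-trans (s≤s z≤n) m≥M
    dense : C * length (vertices J) ^ s ≤ m ^ (2 * suc σ)
    dense = power-gap {c = c} {C = C} {a = a} (2 * suc σ) s 0<d 0<m
      (subst₂ (λ s p → a * s < p * d) s≡ p≡ as<pd)
      (subst (λ n → n ^ d ≤ c ^ d * m ^ a) (sym (length-elements (V J))) (bound _ m 0<m small))
      (≤-trans (m≤n+m _ (suc k * 2)) m≥M)
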